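{- (i) For integers $k\ge 3$ and $n\ge 4k-3$, $\mathrm{sat}(n,k\mathcal{C}_{\ge3})\le n+6k-7$. (ii) For integers $k\ge 5$ and $n\ge 4k^2-21k+37$, $$[n+6k-7,\,(2k-5)n-6k^2+21k-3]\subset \mathrm{ES}(n,k\mathcal{C}_{\ge3}).$$
   Context: All graphs are finite and simple. For integers $a\le b$, $[a,b]=\{a,\dots,b\}$. For a family $\mathcal{H}$ of graphs, a graph $G$ is $\mathcal{H}$-saturated if $G$ contains no subgraph isomorphic to a member of $\mathcal{H}$, but for every pair of non-adjacent vertices $u,v$ the graph $G+uv$ contains a subgraph isomorphic to some member of $\mathcal{H}$. $\mathrm{sat}(n,\mathcal{H})$ is the minimum number of edges of an $n$-vertex $\mathcal{H}$-saturated graph, and $\mathrm{ES}(n,\mathcal{H})$ is the set of numbers of edges of all $n$-vertex $\mathcal{H}$-saturated graphs. $k\mathcal{C}_{\ge3}$ is the family of all vertex-disjoint unions of $k$ (not necessarily distinct) cycles of length at least $3$. -}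

module Defs where

open import Data.Nat using (ℕ; zero; suc; _+_; _*_; _∸_; _≤_; _<ᵇ_)
open import Data.Bool using (Bool; true; false; _∧_; _∨_; if_then_else_)
open import Data.Fin using (Fin; toℕ)
open import Data.Fin.Properties using (_≟_)
open import Data.List using (List; []; _∷_; _++_; length; concat; map; allFin)
open import Data.Nat.ListAction using (sum)
open import Data.List.Relation.Unary.All using (All)
open import Data.List.Relation.Unary.Unique.Propositional using (Unique)
open import Data.Product using (Σ; _×_)
open import Data.Unit using (⊤)
open import Relation.Binary.PropositionalEquality using (_≡_; _≢_)
open import Relation.Nullary using (¬_)
open import Relation.Nullary.Decidable using (⌊_⌋)

Adj : ℕ → Set
Adj n = Fin n → Fin n → Bool

record Graph (n : ℕ) : Set where
  field
    adj    : Adj n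
    adj-sym    : ∀ i j → adj i j ≡ adj j i
    adj-irrefl : ∀ i → adj i i ≡ false
open Graph public

edgeCount : ∀ {n} → Graph n → ℕ
edgeCount {n} G =
  sum (map (λ i → sum (map (λ j → if adj G i j ∧ (toℕ i <ᵇ toℕ j) then 1 else 0)
                           (allFin n)))
           (allFin n))

addEdge : ∀ {n} → Adj n → Fin n → Fin n → Adj n
addEdge a u v i j =
  a i j ∨ ((⌊ i ≟ u ⌋ ∧ ⌊ j ≟ v ⌋) ∨ (⌊ i ≟ v ⌋ ∧ ⌊ j ≟ u ⌋))

Walk : ∀ {n} → Adj n → List (Fin n) → Set
Walk a [] = ⊤
Walk a (x ∷ []) = ⊤
Walk a (x ∷ y ∷ r) = (a x y ≡ true) × Walk a (y ∷ r)

-- A cycle x₀ x₁ … x_{l-1} of length l ≥ 3 (vertices are required to be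
-- distinct by the global uniqueness condition in HasKCycles).
IsCycle : ∀ {n} → Adj n → List (Fin n) → Set
IsCycle a [] = Data.Empty.⊥
  where import Data.Empty
IsCycle a (x ∷ xs) = (3 ≤ suc (length xs)) × Walk a (x ∷ xs ++ x ∷ [])

-- The graph contains a subgraph isomorphic to a member of k𝒞_{≥3}:
-- k pairwise vertex-disjoint cycles of length at least 3.
HasKCycles : ∀ {n} → ℕ → Adj n → Set
HasKCycles {n} k a =
  Σ (List (List (Fin n))) λ cs →
    (length cs ≡ k) × All (IsCycle a) cs × Unique (concat cs)

Saturated : ∀ {n} → ℕ → Graph n → Set
Saturated k G =
  ¬ HasKCycles k (adj G) ×
  (∀ u v → u ≢ v → adj G u v ≡ false → HasKCycles k (addEdge (adj G) u v))

InES : ℕ → ℕ → ℕ → Set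
InES n k m = Σ (Graph n) λ G → Saturated k G × (edgeCount G ≡ m)

SatLe : ℕ → ℕ → ℕ → Set
SatLe n k m = Σ (Graph n) λ G → Saturated k G × (edgeCount G ≤ m)

{-# OPTIONS --safe #-}
-- Glue blocks at a common root w. A block consists of pairwise adjacent core vertices and of
-- pairwise non-adjacent independent vertices joined to all of the core, and w counts as one more
-- independent vertex of every block. Take core 3t+1 and no independent vertices, or core 2t+1 and
-- at least t+1 independent vertices. Since w is a cut vertex, every cycle lies in one block
-- together with w, and such a block with w has no t+1 disjoint cycles, because a cycle has
-- at least three vertices, and at least two in the core. Conversely every block packs t disjoint
-- triangles even after losing one core and one independent vertex, and a new edge between two
-- blocks closes a cycle through w that takes no more than that from each. A new edge inside a block
-- joins two independent vertices, and then w replaces the second one.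
-- So the graph is saturated when the capacities t sum to k-1.
--
-- A block with t = 1 exceeds its vertices by 6, 7, 9, 11, … edges, so two of them provide
-- every excess 12 + r using about r/2 + 9 vertices. A single large block with core 2t+1 adds 2t
-- edges beyond its vertices per independent vertex, and two blocks of capacity 1 fill the gaps
-- of length 2t. Letting t run from 1 to k-3 gives intervals that overlap and cover the range.
module Submission where

open import Defs
open import Data.Bool using (Bool; true; false; T; _∧_; _∨_; not; if_then_else_)
import Data.Bool.Properties as Bool
open import Data.Fin as Fin using (Fin; toℕ)
import Data.Fin.Properties as Fin
open import Data.List
  using (List; []; _∷_; _++_; length; concat; map; filter; replicate; allFin; tabulate; lookup; take; drop)
open import Data.List.Membership.Propositional using (_∈_; _∉_)
open import Data.List.Membership.Propositional.Properties
  using (∈-∃++; ∈-++⁺ˡ; ∈-++⁺ʳ; ∈-++⁻; ∈-map⁻; ∈-filter⁺; ∈-filter⁻; ∈-allFin; ∈-lookup)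
import Data.List.Membership.DecPropositional as DecMembership
open import Data.List.Properties
  using (length-++; length-map; length-take; length-drop; map-++; map-tabulate; tabulate-lookup;
         filter-accept; filter-reject; filter-++; filter-all; take++drop≡id; concat-++; ++-assoc)
open import Data.List.Relation.Binary.Permutation.Propositional using (↭⇒↭ₛ)
open import Data.List.Relation.Binary.Permutation.Propositional.Properties using (shift)
import Data.List.Relation.Binary.Permutation.Setoid.Properties as PermutationSetoid
open import Data.List.Relation.Unary.All as All using (All; []; _∷_)
import Data.List.Relation.Unary.All.Properties as All
open import Data.List.Relation.Unary.AllPairs using ([]; _∷_)
open import Data.List.Relation.Unary.Any using (here; there)
open import Data.List.Relation.Unary.Unique.Propositional using (Unique)
import Data.List.Relation.Unary.Unique.Propositional.Properties as Unique
open import Data.Nat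
  using (ℕ; zero; suc; pred; _+_; _*_; _∸_; _/_; _%_; _≤_; _<_; NonZero; _≡ᵇ_; _<ᵇ_; z≤n; s≤s; s≤s⁻¹)
open import Data.Nat.DivMod using (m≡m%n+[m/n]*n; m%n<n)
open import Data.Nat.ListAction using (sum)
open import Data.Nat.ListAction.Properties using (sum-++)
import Data.Nat.Properties as ℕ
open import Data.Nat.Tactic.RingSolver using (solve-∀)
open import Data.Product using (∃; ∃-syntax; _×_; _,_; proj₁; proj₂)
open import Data.Product.Properties using (≡-dec)
open import Data.Sum using (_⊎_; inj₁; inj₂; [_,_]′)
open import Function using (_∘_; id)
open import Relation.Binary.Definitions using (DecidableEquality)
open import Relation.Binary.PropositionalEquality
  using (_≡_; _≢_; refl; sym; trans; cong; cong₂; subst; subst₂; setoid; ≢-sym; module ≡-Reasoning)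
open import Relation.Nullary using (¬_; yes; no; contradiction; ¬?)
open import Relation.Nullary.Decidable using (⌊_⌋; _⊎-dec_)
open import Relation.Unary using (Decidable)

-- Duplicate-free lists and disjoint triangles

Unique-++⁻ : ∀ {A : Set} (xs : List A) {ys} → Unique (xs ++ ys) → Unique xs × Unique ys
Unique-++⁻ []       u        = [] , u
Unique-++⁻ (x ∷ xs) (px ∷ u) =
  let ux , uy = Unique-++⁻ xs u in All.++⁻ˡ xs px ∷ ux , uy

Unique-⊆⇒length≤ : ∀ {A : Set} {xs ys : List A} → Unique xs → (∀ {v} → v ∈ xs → v ∈ ys) → length xs ≤ length ys
Unique-⊆⇒length≤ {xs = []}     []       sub = z≤n
Unique-⊆⇒length≤ {xs = x ∷ xs} (px ∷ u) sub with ∈-∃++ (sub (here refl))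
... | as , bs , refl = begin
  suc (length xs)               ≤⟨ s≤s (Unique-⊆⇒length≤ u sub′) ⟩
  suc (length (as ++ bs))       ≡⟨ cong suc (length-++ as) ⟩
  suc (length as + length bs)   ≡⟨ sym (ℕ.+-suc (length as) (length bs)) ⟩
  length as + suc (length bs)   ≡⟨ sym (length-++ as) ⟩
  length (as ++ x ∷ bs)         ∎
  where
  open ℕ.≤-Reasoning
  sub′ : ∀ {v} → v ∈ xs → v ∈ as ++ bs
  sub′ v∈ with ∈-++⁻ as (sub (there v∈))
  ... | inj₁ v∈as         = ∈-++⁺ˡ v∈as
  ... | inj₂ (here v≡x)   = contradiction (sym v≡x) (All.lookup px v∈)
  ... | inj₂ (there v∈bs) = ∈-++⁺ʳ as v∈bs

module _ {A : Set} (_≟_ : DecidableEquality A) where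
  open DecMembership _≟_ using (_∈?_)

  avoiding : List A → List A → List A
  avoiding R = filter (λ v → ¬? (v ∈? R))

  -- Only the part of `R` that meets `xs` is lost, and `R′` bounds that part. It is used with an
  -- `R′` shorter than `R`.
  length-avoiding : ∀ {xs} R R′ → Unique xs → (∀ {v} → v ∈ R → v ∈ xs → v ∈ R′) →
                    length xs ≤ length (avoiding R xs) + length R′
  length-avoiding {xs = xs} R R′ u sub =
    ℕ.≤-trans (Unique-⊆⇒length≤ u sub′) (ℕ.≤-reflexive (length-++ (avoiding R xs)))
    where
    sub′ : ∀ {v} → v ∈ xs → v ∈ avoiding R xs ++ R′
    sub′ {v} v∈ with v ∈? R
    ... | yes v∈R = ∈-++⁺ʳ (avoiding R xs) (sub v∈R v∈)
    ... | no  v∉R = ∈-++⁺ˡ (∈-filter⁺ (λ v → ¬? (v ∈? R)) v∈ v∉R)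

module _ {n} {a : Adj n} (a-sym : ∀ u v → a u v ≡ a v u)
  {P Q : Fin n → Set} (P⇒Q : ∀ {v} → P v → Q v)
  (edge : ∀ {u v} → P u → Q v → u ≢ v → a u v ≡ true) where

  -- Greedy choice: each triangle takes the next two vertices of `xs` and the next one of `ys`.
  -- Since `P` implies `Q`, the list `ys` may itself consist of core vertices, as it will for a
  -- clique.
  triangles : ∀ t (xs ys : List (Fin n)) → All P xs → All Q ys → Unique (xs ++ ys) →
              t + t ≤ length xs → t ≤ length ys →
              ∃ λ cs → length cs ≡ t × All (IsCycle a) cs × Unique (concat cs) ×
                       (∀ {v} → v ∈ concat cs → v ∈ xs ++ ys)
  triangles zero xs ys _ _ _ _ _ = [] , refl , [] , [] , λ ()
  triangles (suc t) (x ∷ y ∷ xs) (z ∷ ys) (px ∷ py ∷ pxs) (qz ∷ qys) ((x≢y ∷ x≢) ∷ y≢ ∷ u)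
            (s≤s 2t≤) (s≤s t≤)
    with PermutationSetoid.Unique-resp-↭ (setoid (Fin n)) (↭⇒↭ₛ (shift z xs ys)) u
  ... | z≢ ∷ u′
    with triangles t xs ys pxs qys u′ (s≤s⁻¹ (ℕ.≤-trans (ℕ.≤-reflexive (sym (ℕ.+-suc t t))) 2t≤)) t≤
  ... | cs , refl , cyc , ucs , sub =
      (x ∷ y ∷ z ∷ []) ∷ cs , refl ,
      (s≤s (s≤s (s≤s z≤n)) ,
       edge px (P⇒Q py) x≢y , edge py qz (at y≢) , trans (a-sym z x) (edge px qz (at x≢)) , _) ∷ cyc ,
      (x≢y ∷ at x≢ ∷ away x≢) ∷ (at y≢ ∷ away y≢) ∷ All.tabulate (All.lookup z≢ ∘ sub) ∷ ucs ,
      sub′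
    where
    insert : ∀ {v} → v ∈ xs ++ ys → v ∈ xs ++ z ∷ ys
    insert v∈ = [ ∈-++⁺ˡ , ∈-++⁺ʳ xs ∘ there ]′ (∈-++⁻ xs v∈)
    at : ∀ {w} → All (w ≢_) (xs ++ z ∷ ys) → w ≢ z
    at w≢ = All.lookup w≢ (∈-++⁺ʳ xs (here refl))
    away : ∀ {w} → All (w ≢_) (xs ++ z ∷ ys) → All (w ≢_) (concat cs)
    away w≢ = All.tabulate (All.lookup w≢ ∘ insert ∘ sub)
    sub′ : ∀ {v} → v ∈ x ∷ y ∷ z ∷ concat cs → v ∈ x ∷ y ∷ xs ++ z ∷ ys
    sub′ (here e)                 = here e
    sub′ (there (here e))         = there (here e)
    sub′ (there (there (here e))) = there (there (∈-++⁺ʳ xs (here e)))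
    sub′ (there (there (there i))) = there (there (insert (sub i)))
  triangles (suc t) (x ∷ []) ys _ _ _ (s≤s 2t≤) _ = contradiction (ℕ.≤-trans (ℕ.≤-reflexive (sym (ℕ.+-suc t t))) 2t≤) λ ()

-- Blocks and the graph glued from them

data Block : Set where
  clique : (t : ℕ) → Block
  join   : (t s : ℕ) → Block

coreSize : Block → ℕ
coreSize (clique t) = suc (t + t + t)
coreSize (join t s) = suc (t + t)

indepSize : Block → ℕ
indepSize (clique t) = 0
indepSize (join t s) = suc (t + s)

capacity : Block → ℕ
capacity (clique t) = t
capacity (join t s) = t

blockSize : Block → ℕ
blockSize B = coreSize B + indepSize B

-- The binomial coefficient c over 2, the number of edges of a complete graph on c vertices.
triangular : ℕ → ℕ
triangular zero    = 0
triangular (suc c) = c + triangular c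

-- The first summand counts the edges from the core to the root, which are charged to the block.
blockEdges : Block → ℕ
blockEdges B = coreSize B + (triangular (coreSize B) + coreSize B * indepSize B)

Label : Set
Label = ℕ × Bool

_≟ᴸ_ : DecidableEquality Label
_≟ᴸ_ = ≡-dec ℕ._≟_ Bool._≟_

-- In the layout the number 0 is reserved for the root, which meets every block. The blocks
-- themselves are numbered from 0 in a list and hence from 1 in its layout.
raise : Label → Label
raise (x , p) = suc x , p

labels : List Block → List Label
labels []       = []
labels (B ∷ Bs) =
  replicate (coreSize B) (0 , true) ++ replicate (indepSize B) (0 , false) ++ map raise (labels Bs)

layout : List Block → List Label
layout Bs = (0 , false) ∷ map raise (labels Bs)

meets : ℕ → ℕ → Bool
meets zero    y       = true
meets (suc x) zero    = true
meets (suc x) (suc y) = x ≡ᵇ y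

-- `linked` treats number 0 as the root, while `within` knows no root. On raised labels `linked`
-- reduces to `within` on the original ones, so the edges off the root can be counted separately.
linked within : Label → Label → Bool
linked (x , p) (y , q) = (p ∨ q) ∧ meets x y
within (x , p) (y , q) = (p ∨ q) ∧ (x ≡ᵇ y)

meets-sym : ∀ x y → meets x y ≡ meets y x
meets-sym zero    zero    = refl
meets-sym zero    (suc y) = refl
meets-sym (suc x) zero    = refl
meets-sym (suc x) (suc y) = ≡ᵇ-sym x y
  where
  ≡ᵇ-sym : ∀ x y → (x ≡ᵇ y) ≡ (y ≡ᵇ x)
  ≡ᵇ-sym zero    zero    = refl
  ≡ᵇ-sym zero    (suc y) = refl
  ≡ᵇ-sym (suc x) zero    = refl
  ≡ᵇ-sym (suc x) (suc y) = ≡ᵇ-sym x y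

linked-sym : ∀ k l → linked k l ≡ linked l k
linked-sym (x , p) (y , q) = cong₂ _∧_ (Bool.∨-comm p q) (meets-sym x y)

-- All core vertices of a block share one label, which is linked to itself. Loops are therefore
-- excluded by position and not by label.
labelAdj : (L : List Label) → Adj (length L)
labelAdj L i j = not ⌊ i Fin.≟ j ⌋ ∧ linked (lookup L i) (lookup L j)

labelGraph : (L : List Label) → Graph (length L)
labelGraph L .adj = labelAdj L
labelGraph L .adj-sym i j with i Fin.≟ j | j Fin.≟ i
... | yes _   | yes _   = refl
... | yes i≡j | no  j≢i = contradiction (sym i≡j) j≢i
... | no  i≢j | yes j≡i = contradiction (sym j≡i) i≢j
... | no  _   | no  _   = linked-sym (lookup L i) (lookup L j)
labelGraph L .adj-irrefl i with i Fin.≟ i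
... | yes _   = refl
... | no  i≢i = contradiction refl i≢i

-- Counting the edges

indicator : Bool → ℕ
indicator b = if b then 1 else 0

degree : (Label → Label → Bool) → Label → List Label → ℕ
degree R l L = sum (map (indicator ∘ R l) L)

-- Each entry is tested against later entries only, which mirrors the condition `toℕ i <ᵇ toℕ j` in
-- `edgeCount`.
pairs : (Label → Label → Bool) → List Label → ℕ
pairs R []      = 0
pairs R (l ∷ L) = degree R l L + pairs R L

sum-cong : ∀ {n} {f g : Fin n → ℕ} → (∀ i → f i ≡ g i) → sum (tabulate f) ≡ sum (tabulate g)
sum-cong {zero}  eq = refl
sum-cong {suc n} eq = cong₂ _+_ (eq Fin.zero) (sum-cong (eq ∘ Fin.suc))

sum-tabulate-lookup : ∀ (f : Label → ℕ) L → sum (tabulate (f ∘ lookup L)) ≡ sum (map f L)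
sum-tabulate-lookup f []      = refl
sum-tabulate-lookup f (l ∷ L) = cong (f l +_) (sum-tabulate-lookup f L)

-- Peel off the first position: in its row every comparison holds except on the diagonal, and in its
-- column none does.
sum-pairs : ∀ R L →
  sum (tabulate λ i → sum (tabulate λ j → indicator (R (lookup L i) (lookup L j) ∧ (toℕ i <ᵇ toℕ j))))
  ≡ pairs R L
sum-pairs R []      = refl
sum-pairs R (l ∷ L) = cong₂ _+_
  (cong₂ _+_ (cong indicator (Bool.∧-zeroʳ (R l l)))
    (trans (sum-cong λ j → cong indicator (Bool.∧-identityʳ (R l (lookup L j))))
           (sum-tabulate-lookup (indicator ∘ R l) L)))
  (trans (sum-cong λ i → cong (_+ rest i) (cong indicator (Bool.∧-zeroʳ (R (lookup L i) l)))) (sum-pairs R L))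
  where
  rest : Fin (length L) → ℕ
  rest i = sum (tabulate λ j → indicator (R (lookup L i) (lookup L j) ∧ (toℕ i <ᵇ toℕ j)))

n≮ᵇn : ∀ m → (m <ᵇ m) ≡ false
n≮ᵇn zero    = refl
n≮ᵇn (suc m) = n≮ᵇn m

sum-allFin : ∀ {n} (f : Fin n → ℕ) → sum (map f (allFin n)) ≡ sum (tabulate f)
sum-allFin f = cong sum (map-tabulate id f)

edgeCount-labelGraph : ∀ L → edgeCount (labelGraph L) ≡ pairs linked L
edgeCount-labelGraph L = begin
  edgeCount (labelGraph L)                              ≡⟨ sum-allFin (λ i → sum (map (entry i) (allFin _))) ⟩
  sum (tabulate λ i → sum (map (entry i) (allFin _)))   ≡⟨ sum-cong (λ i → sum-allFin (entry i)) ⟩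
  sum (tabulate λ i → sum (tabulate (entry i)))         ≡⟨ sum-cong (λ i → sum-cong λ j → cong indicator (drop-≢ i j)) ⟩
  sum (tabulate λ i → sum (tabulate λ j → indicator (linked (lookup L i) (lookup L j) ∧ (toℕ i <ᵇ toℕ j))))
                                                        ≡⟨ sum-pairs linked L ⟩
  pairs linked L                                        ∎
  where
  open ≡-Reasoning
  entry : Fin (length L) → Fin (length L) → ℕ
  entry i j = indicator (labelAdj L i j ∧ (toℕ i <ᵇ toℕ j))
  -- The test against loops is absorbed by the strict comparison, which fails on the diagonal
  -- anyway.
  drop-≢ : ∀ i j → labelAdj L i j ∧ (toℕ i <ᵇ toℕ j) ≡ linked (lookup L i) (lookup L j) ∧ (toℕ i <ᵇ toℕ j)
  drop-≢ i j with i Fin.≟ j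
  ... | yes refl rewrite n≮ᵇn (toℕ i) = sym (Bool.∧-zeroʳ _)
  ... | no  _    = refl

degree-raise : ∀ R R′ l l′ L → (∀ k → R l (raise k) ≡ R′ l′ k) →
               degree R l (map raise L) ≡ degree R′ l′ L
degree-raise R R′ l l′ []      eq = refl
degree-raise R R′ l l′ (k ∷ L) eq = cong₂ _+_ (cong indicator (eq k)) (degree-raise R R′ l l′ L eq)

pairs-raise : ∀ R R′ L → (∀ k l → R (raise k) (raise l) ≡ R′ k l) →
              pairs R (map raise L) ≡ pairs R′ L
pairs-raise R R′ []      eq = refl
pairs-raise R R′ (l ∷ L) eq =
  cong₂ _+_ (degree-raise R R′ (raise l) l L (eq l)) (pairs-raise R R′ L eq)

degree-replicate : ∀ R l k c L → R l k ≡ true → degree R l (replicate c k ++ L) ≡ c + degree R l L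
degree-replicate R l k zero    L eq = refl
degree-replicate R l k (suc c) L eq = cong₂ _+_ (cong indicator eq) (degree-replicate R l k c L eq)

degree-replicate-0 : ∀ R l k c L → R l k ≡ false → degree R l (replicate c k ++ L) ≡ degree R l L
degree-replicate-0 R l k zero    L eq = refl
degree-replicate-0 R l k (suc c) L eq = cong₂ _+_ (cong indicator eq) (degree-replicate-0 R l k c L eq)

degree-zero : ∀ R l L → (∀ k → R l (raise k) ≡ false) → degree R l (map raise L) ≡ 0
degree-zero R l []      eq = refl
degree-zero R l (k ∷ L) eq = cong₂ _+_ (cong indicator (eq k)) (degree-zero R l L eq)

-- The c equal labels form a complete graph, and each of them has d further neighbours in `L`.
pairs-replicate : ∀ R k c L d → R k k ≡ true → degree R k L ≡ d →
                  pairs R (replicate c k ++ L) ≡ triangular c + c * d + pairs R L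
pairs-replicate R k zero    L d eq deg = refl
pairs-replicate R k (suc c) L d eq deg
  rewrite degree-replicate R k k c L eq | pairs-replicate R k c L d eq deg | deg =
  arith c d (triangular c) (pairs R L)
  where
  arith : ∀ c d e p → c + d + (e + c * d + p) ≡ c + e + (d + c * d) + p
  arith = solve-∀

pairs-replicate-0 : ∀ R k c L → R k k ≡ false → degree R k L ≡ 0 →
                    pairs R (replicate c k ++ L) ≡ pairs R L
pairs-replicate-0 R k zero    L eq deg = refl
pairs-replicate-0 R k (suc c) L eq deg
  rewrite degree-replicate-0 R k k c L eq | deg = pairs-replicate-0 R k c L eq deg

coreTotal : List Block → ℕ
coreTotal Bs = sum (map coreSize Bs)

degree-root : ∀ Bs → degree linked (0 , false) (map raise (labels Bs)) ≡ coreTotal Bs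
degree-root Bs = trans (degree-raise linked R (0 , false) (0 , false) (labels Bs) λ _ → refl) (go Bs)
  where
  -- `R` is the view from the root of a raised label. Raising once more changes nothing, because the
  -- root meets every number, so the same `R` serves throughout the recursion.
  R : Label → Label → Bool
  R _ l = linked (0 , false) (raise l)
  go : ∀ Bs → degree R (0 , false) (labels Bs) ≡ coreTotal Bs
  go []       = refl
  go (B ∷ Bs) = begin
    degree R (0 , false) (labels (B ∷ Bs))
      ≡⟨ degree-replicate R (0 , false) (0 , true) (coreSize B) _ refl ⟩
    coreSize B + degree R (0 , false) (replicate (indepSize B) (0 , false) ++ map raise (labels Bs))
      ≡⟨ cong (coreSize B +_) (degree-replicate-0 R (0 , false) (0 , false) (indepSize B) _ refl) ⟩
    coreSize B + degree R (0 , false) (map raise (labels Bs))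
      ≡⟨ cong (coreSize B +_) (degree-raise R R (0 , false) (0 , false) (labels Bs) λ _ → refl) ⟩
    coreSize B + degree R (0 , false) (labels Bs)
      ≡⟨ cong (coreSize B +_) (go Bs) ⟩
    coreSize B + coreTotal Bs ∎
    where open ≡-Reasoning

-- The root has one edge to each core vertex. Adding `coreTotal Bs` distributes these edges over the
-- blocks.
pairs-within : ∀ Bs → coreTotal Bs + pairs within (labels Bs) ≡ sum (map blockEdges Bs)
pairs-within []       = refl
pairs-within (B ∷ Bs) = begin
  c + coreTotal Bs + pairs within (labels (B ∷ Bs))
    ≡⟨ cong (c + coreTotal Bs +_) (pairs-replicate within (0 , true) c _ i refl
         (trans (degree-replicate within (0 , true) (0 , false) i (map raise (labels Bs)) refl)
                (trans (cong (i +_) (degree-zero within (0 , true) (labels Bs) λ _ → refl)) (ℕ.+-identityʳ i)))) ⟩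
  c + coreTotal Bs + (triangular c + c * i + pairs within (replicate i (0 , false) ++ map raise (labels Bs)))
    ≡⟨ cong (λ z → c + coreTotal Bs + (triangular c + c * i + z))
         (trans (pairs-replicate-0 within (0 , false) i _ refl (degree-zero within (0 , false) (labels Bs) λ k → Bool.∧-zeroʳ (proj₂ k)))
                (pairs-raise within within (labels Bs) λ _ _ → refl)) ⟩
  c + coreTotal Bs + (triangular c + c * i + pairs within (labels Bs))
    ≡⟨ arith c (coreTotal Bs) (triangular c + c * i) (pairs within (labels Bs)) ⟩
  blockEdges B + (coreTotal Bs + pairs within (labels Bs))
    ≡⟨ cong (blockEdges B +_) (pairs-within Bs) ⟩
  blockEdges B + sum (map blockEdges Bs) ∎
  where
  open ≡-Reasoning
  c = coreSize B
  i = indepSize B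
  arith : ∀ a b d e → a + b + (d + e) ≡ a + d + (b + e)
  arith = solve-∀

blockGraph : (Bs : List Block) → Graph (length (layout Bs))
blockGraph Bs = labelGraph (layout Bs)

edgeCount-blockGraph : ∀ Bs → edgeCount (blockGraph Bs) ≡ sum (map blockEdges Bs)
edgeCount-blockGraph Bs = trans (edgeCount-labelGraph (layout Bs))
  (trans (cong₂ _+_ (degree-root Bs) (pairs-raise linked within (labels Bs) λ _ _ → refl)) (pairs-within Bs))

length-layout : ∀ Bs → length (layout Bs) ≡ suc (sum (map blockSize Bs))
length-layout Bs = cong suc (trans (length-map raise (labels Bs)) (go Bs))
  where
  go : ∀ Bs → length (labels Bs) ≡ sum (map blockSize Bs)
  go []       = refl
  go (B ∷ Bs) = begin
    length (labels (B ∷ Bs))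
      ≡⟨ length-replicate-++ (coreSize B) ⟩
    coreSize B + length (replicate (indepSize B) (0 , false) ++ map raise (labels Bs))
      ≡⟨ cong (coreSize B +_) (length-replicate-++ (indepSize B)) ⟩
    coreSize B + (indepSize B + length (map raise (labels Bs)))
      ≡⟨ cong (λ z → coreSize B + (indepSize B + z)) (trans (length-map raise (labels Bs)) (go Bs)) ⟩
    coreSize B + (indepSize B + sum (map blockSize Bs))
      ≡⟨ sym (ℕ.+-assoc (coreSize B) (indepSize B) _) ⟩
    blockSize B + sum (map blockSize Bs) ∎
    where
    open ≡-Reasoning
    length-replicate-++ : ∀ c {k : Label} {L} → length (replicate c k ++ L) ≡ c + length L
    length-replicate-++ zero    = refl
    length-replicate-++ (suc c) = cong suc (length-replicate-++ c)

-- Label classes and their sizes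

infix 4 _[_]=_
data _[_]=_ : List Block → ℕ → Block → Set where
  here  : ∀ {B Bs} → (B ∷ Bs) [ 0 ]= B
  there : ∀ {B B′ Bs y} → Bs [ y ]= B → (B′ ∷ Bs) [ suc y ]= B

count : Label → List Label → ℕ
count l L = length (filter (_≟ᴸ l) L)

count-≡ : ∀ l k L → k ≡ l → count l (k ∷ L) ≡ suc (count l L)
count-≡ l k L k≡l = cong length (filter-accept (_≟ᴸ l) k≡l)

count-≢ : ∀ l k L → k ≢ l → count l (k ∷ L) ≡ count l L
count-≢ l k L k≢l = cong length (filter-reject (_≟ᴸ l) k≢l)

count-replicate : ∀ l c L → count l (replicate c l ++ L) ≡ c + count l L
count-replicate l zero    L = refl
count-replicate l (suc c) L = trans (count-≡ l l _ refl) (cong suc (count-replicate l c L))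

count-skip : ∀ l k c L → k ≢ l → count l (replicate c k ++ L) ≡ count l L
count-skip l k zero    L k≢l = refl
count-skip l k (suc c) L k≢l = trans (count-≢ l k _ k≢l) (count-skip l k c L k≢l)

count-raise : ∀ l L → count (raise l) (map raise L) ≡ count l L
count-raise l []      = refl
count-raise l (k ∷ L) with k ≟ᴸ l
... | yes refl = trans (count-≡ (raise l) (raise l) _ refl) (cong suc (count-raise l L))
... | no  k≢l  = trans (count-≢ (raise l) (raise k) _ λ { refl → k≢l refl }) (count-raise l L)

count-raise-0 : ∀ p L → count (0 , p) (map raise L) ≡ 0
count-raise-0 p []      = refl
count-raise-0 p (k ∷ L) = trans (count-≢ (0 , p) (raise k) (map raise L) λ ()) (count-raise-0 p L)

classSize : Bool → Block → ℕ
classSize true  = coreSize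
classSize false = indepSize

count-labels : ∀ p {Bs y B} → Bs [ y ]= B → count (y , p) (labels Bs) ≡ classSize p B
count-labels true {B ∷ Bs} here =
  trans (count-replicate (0 , true) (coreSize B) _) (trans (cong (coreSize B +_)
    (trans (count-skip (0 , true) (0 , false) (indepSize B) _ λ ()) (count-raise-0 true (labels Bs))))
    (ℕ.+-identityʳ _))
count-labels false {B ∷ Bs} here =
  trans (count-skip (0 , false) (0 , true) (coreSize B) _ λ ())
    (trans (count-replicate (0 , false) (indepSize B) _)
      (trans (cong (indepSize B +_) (count-raise-0 false (labels Bs))) (ℕ.+-identityʳ _)))
count-labels p {B′ ∷ Bs} {suc y} (there i) =
  trans (count-skip (suc y , p) (0 , true) (coreSize B′) _ λ ())
    (trans (count-skip (suc y , p) (0 , false) (indepSize B′) _ λ ())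
      (trans (count-raise (y , p) (labels Bs)) (count-labels p i)))

count-layout : ∀ p {Bs y B} → Bs [ y ]= B → count (suc y , p) (layout Bs) ≡ classSize p B
count-layout p {Bs} {y} i =
  trans (count-≢ (suc y , p) (0 , false) (map raise (labels Bs)) λ ())
    (trans (count-raise (y , p) (labels Bs)) (count-labels p i))

labels-valid : ∀ {Bs y p} → (y , p) ∈ labels Bs → ∃ λ B → Bs [ y ]= B
labels-valid {B ∷ Bs} l∈ with ∈-++⁻ (replicate (coreSize B) (0 , true)) l∈
... | inj₁ l∈c with refl ← All.lookup {P = _≡ (0 , true)} (All.replicate⁺ (coreSize B) refl) l∈c = B , here
... | inj₂ l∈′ with ∈-++⁻ (replicate (indepSize B) (0 , false)) l∈′
...   | inj₁ l∈i with refl ← All.lookup {P = _≡ (0 , false)} (All.replicate⁺ (indepSize B) refl) l∈i = B , here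
...   | inj₂ l∈r with ∈-map⁻ raise l∈r
...     | _ , k∈ , refl with labels-valid k∈
...       | B′ , i = B′ , there i

module Vertices (L : List Label) where

  V : Set
  V = Fin (length L)

  lab : V → Label
  lab = lookup L

  abstract
    class : Label → List V
    class l = filter (λ v → lab v ≟ᴸ l) (allFin (length L))

    length-class : ∀ l → length (class l) ≡ count l L
    length-class l = trans (go (allFin (length L)))
      (cong (count l) (trans (map-tabulate id lab) (tabulate-lookup L)))
      where
      go : ∀ vs → length (filter (λ v → lab v ≟ᴸ l) vs) ≡ count l (map lab vs)
      go []       = refl
      go (v ∷ vs) with lab v ≟ᴸ l
      ... | yes _ = cong suc (go vs)
      ... | no  _ = go vs

    ∈-class : ∀ v → v ∈ class (lab v)
    ∈-class v = ∈-filter⁺ (λ w → lab w ≟ᴸ lab v) (∈-allFin v) refl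

    class-lab : ∀ l {v} → v ∈ class l → lab v ≡ l
    class-lab l v∈ = proj₂ (∈-filter⁻ (λ w → lab w ≟ᴸ l) {xs = allFin (length L)} v∈)

    class-unique : ∀ l → Unique (class l)
    class-unique l = Unique.filter⁺ (λ v → lab v ≟ᴸ l) (Unique.allFin⁺ (length L))

-- Disjoint cycles are bounded by the capacity

meets⇒ : ∀ x y → meets x y ≡ true → x ≡ 0 ⊎ y ≡ 0 ⊎ x ≡ y
meets⇒ zero    y       eq = inj₁ refl
meets⇒ (suc x) zero    eq = inj₂ (inj₁ refl)
meets⇒ (suc x) (suc y) eq = inj₂ (inj₂ (cong suc (ℕ.≡ᵇ⇒≡ x y (subst T (sym eq) _))))

module _ {A : Set} {P Q : A → Set} (P? : Decidable P) (Q? : Decidable Q) where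

  length-filter-mono : ∀ {xs} → All (λ x → P x → Q x) xs → length (filter P? xs) ≤ length (filter Q? xs)
  length-filter-mono {[]} [] = z≤n
  length-filter-mono {x ∷ xs} (f ∷ fs) with P? x | Q? x
  ... | yes p | yes q = s≤s (length-filter-mono fs)
  ... | yes p | no ¬q = contradiction (f p) ¬q
  ... | no ¬p | yes q = ℕ.m≤n⇒m≤1+n (length-filter-mono fs)
  ... | no ¬p | no ¬q = length-filter-mono fs

module _ {A : Set} {P : A → Set} (P? : Decidable P) (g : List A → ℕ) (w y : ℕ) where

  -- Double counting: every list that `g` sends to `y` contributes at least `w` entries satisfying
  -- `P`. The lists will be the cycles, and `P` will single out vertices of one block.
  weigh : ∀ {cs} → All (λ c → g c ≡ y → w ≤ length (filter P? c)) cs →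
          length (filter (ℕ._≟ y) (map g cs)) * w ≤ length (filter P? (concat cs))
  weigh {[]}     []       = z≤n
  weigh {c ∷ cs} (h ∷ hs) rewrite filter-++ P? c (concat cs) | length-++ (filter P? c) {filter P? (concat cs)}
    with g c ≡ᵇ y in eq
  ... | true  = ℕ.+-mono-≤ (h (ℕ.≡ᵇ⇒≡ (g c) y (subst T (sym eq) _))) (weigh hs)
  ... | false = ℕ.m≤n⇒m≤o+n (length (filter P? c)) (weigh hs)

totalCapacity : List Block → ℕ
totalCapacity Bs = sum (map capacity Bs)

-- Passes from positions in `B ∷ Bs` to positions in `Bs`, discarding those of the head.
preds : List ℕ → List ℕ
preds []           = []
preds (zero  ∷ ns) = preds ns
preds (suc y ∷ ns) = y ∷ preds ns

length-preds : ∀ ns → length ns ≡ length (filter (ℕ._≟ 0) ns) + length (preds ns)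
length-preds []           = refl
length-preds (zero  ∷ ns) = cong suc (length-preds ns)
length-preds (suc y ∷ ns) = trans (cong suc (length-preds ns)) (sym (ℕ.+-suc _ _))

count-preds : ∀ y ns → length (filter (ℕ._≟ y) (preds ns)) ≡ length (filter (ℕ._≟ suc y) ns)
count-preds y []           = refl
count-preds y (zero  ∷ ns) = count-preds y ns
count-preds y (suc z ∷ ns) with z ≡ᵇ y
... | true  = cong suc (count-preds y ns)
... | false = count-preds y ns

-- Summation over the blocks: the zeros among `ns` belong to the head, and `preds` hands the other
-- entries to the tail.
capacity-bound : ∀ Bs ns → All (λ y → ∃ λ B → Bs [ y ]= B) ns →
                 (∀ {y B} → Bs [ y ]= B → length (filter (ℕ._≟ y) ns) ≤ capacity B) →
                 length ns ≤ totalCapacity Bs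
capacity-bound []       []       _ _ = z≤n
capacity-bound []       (y ∷ ns) ((_ , ()) ∷ _) _
capacity-bound (B ∷ Bs) ns       vs bound = begin
  length ns                                           ≡⟨ length-preds ns ⟩
  length (filter (ℕ._≟ 0) ns) + length (preds ns)     ≤⟨ ℕ.+-mono-≤ (bound here)
                                                          (capacity-bound Bs (preds ns) (valid vs) bound′) ⟩
  capacity B + totalCapacity Bs                       ∎
  where
  open ℕ.≤-Reasoning
  valid : ∀ {ns} → All (λ y → ∃ λ B′ → (B ∷ Bs) [ y ]= B′) ns → All (λ y → ∃ λ B′ → Bs [ y ]= B′) (preds ns)
  valid {[]}         []                    = []
  valid {zero  ∷ ns} (_ ∷ vs)              = valid vs
  valid {suc y ∷ ns} ((B′ , there i) ∷ vs) = (B′ , i) ∷ valid vs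
  bound′ : ∀ {y B′} → Bs [ y ]= B′ → length (filter (ℕ._≟ y) (preds ns)) ≤ capacity B′
  bound′ {y} i = ℕ.≤-trans (ℕ.≤-reflexive (count-preds y ns)) (bound (there i))

walk-tail : ∀ {n} {a : Adj n} x xs → Walk a (x ∷ xs) → Walk a xs
walk-tail x []       _ = _
walk-tail x (y ∷ xs) w = proj₂ w

concat-Unique⁻ : ∀ {A : Set} (cs : List (List A)) → Unique (concat cs) → All Unique cs
concat-Unique⁻ []       _ = []
concat-Unique⁻ (c ∷ cs) u = let uc , ucs = Unique-++⁻ c u in uc ∷ concat-Unique⁻ cs ucs

module BlockGraph (Bs : List Block) where
  open Vertices (layout Bs) public

  a : Adj (length (layout Bs))
  a = labelAdj (layout Bs)

  root : V
  root = Fin.zero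

  blk : V → ℕ
  blk v = proj₁ (lab v)

  core : V → Bool
  core v = proj₂ (lab v)

  valid : ∀ v → v ≢ root → ∃ λ B → Bs [ pred (blk v) ]= B × blk v ≡ suc (pred (blk v))
  valid Fin.zero    v≢ = contradiction refl v≢
  valid (Fin.suc v) v≢ with lookup (map raise (labels Bs)) v | ∈-map⁻ raise (∈-lookup {xs = map raise (labels Bs)} v)
  ... | _ | l , l∈ , refl = let B , i = labels-valid l∈ in B , i , refl

  edge⇒linked : ∀ u v → a u v ≡ true → linked (lab u) (lab v) ≡ true
  edge⇒linked u v = Bool.∧-conicalʳ (not ⌊ u Fin.≟ v ⌋) _

  edge⇒core : ∀ u v → a u v ≡ true → core u ≡ false → core v ≡ true
  edge⇒core u v e ¬cu with Bool.∧-conicalˡ (core u ∨ core v) _ (edge⇒linked u v e)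
  ... | eq rewrite ¬cu = eq

  blk≡0⇒root : ∀ v → blk v ≡ 0 → v ≡ root
  blk≡0⇒root v eq with v Fin.≟ root
  ... | yes v≡ = v≡
  ... | no  v≢ = contradiction (trans (sym eq) (proj₂ (proj₂ (valid v v≢)))) λ ()

  edge⇒block : ∀ {u v} → u ≢ root → v ≢ root → a u v ≡ true → blk u ≡ blk v
  edge⇒block {u} {v} u≢ v≢ e
    with meets⇒ (blk u) (blk v) (Bool.∧-conicalʳ (core u ∨ core v) _ (edge⇒linked u v e))
  ... | inj₁ eq        = contradiction (blk≡0⇒root u eq) u≢
  ... | inj₂ (inj₁ eq) = contradiction (blk≡0⇒root v eq) v≢
  ... | inj₂ (inj₂ eq) = eq

  -- An edge avoiding the root stays in its block. Nothing is claimed about the endpoint `y`, which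
  -- will be the root itself.
  walk-forward : ∀ x xs {y} → x ≢ root → All (_≢ root) xs → Walk a (x ∷ xs ++ y ∷ []) →
                 All (λ v → blk v ≡ blk x) (x ∷ xs)
  walk-forward x []       x≢ []         w       = refl ∷ []
  walk-forward x (z ∷ xs) x≢ (z≢ ∷ xs≢) (e , w) =
    refl ∷ All.map (λ eq → trans eq (sym (edge⇒block x≢ z≢ e))) (walk-forward z xs z≢ xs≢ w)

  -- The mirror image, for the stretch of a cycle after the root: here the block is known at the end
  -- of the walk.
  walk-backward : ∀ xs {y} → All (_≢ root) xs → y ≢ root → Walk a (xs ++ y ∷ []) →
                  All (λ v → blk v ≡ blk y) xs
  walk-backward []           []              y≢ w       = []
  walk-backward (x ∷ [])     (x≢ ∷ [])       y≢ (e , w) = edge⇒block x≢ y≢ e ∷ []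
  walk-backward (x ∷ z ∷ xs) (x≢ ∷ z≢ ∷ xs≢) y≢ (e , w) with walk-backward (z ∷ xs) (z≢ ∷ xs≢) y≢ w
  ... | eq ∷ eqs = trans (edge⇒block x≢ z≢ e) eq ∷ eq ∷ eqs

  InBlock : ℕ → V → Set
  InBlock b v = v ≡ root ⊎ blk v ≡ b

  -- By uniqueness the root occurs at most once in `xs`. Before it the block is carried forward from
  -- `x`, after it backward from `y`, and these two lie in the same block.
  walk-through : ∀ x xs {y} → x ≢ root → y ≢ root → blk x ≡ blk y → Unique xs →
                 Walk a (x ∷ xs ++ y ∷ []) → All (InBlock (blk y)) xs
  walk-through x []       x≢ y≢ eq u       w       = []
  walk-through x (z ∷ xs) x≢ y≢ eq (z∉ ∷ u) (e , w) with z Fin.≟ root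
  ... | yes refl = inj₁ refl ∷ All.map inj₂ (walk-backward xs (All.map ≢-sym z∉) y≢ (walk-tail z _ w))
  ... | no  z≢   = inj₂ eq′ ∷ walk-through z xs z≢ y≢ eq′ u w
    where eq′ = trans (sym (edge⇒block x≢ z≢ e)) eq

  -- The root is skipped, and 0 is a junk value for lists that are no cycles.
  blockOf : List V → ℕ
  blockOf (x ∷ z ∷ xs) with x Fin.≟ root
  ... | yes _ = pred (blk z)
  ... | no  _ = pred (blk x)
  blockOf _ = 0

  -- A cycle starting at the root avoids it afterwards, so `walk-forward` applies. Any other cycle
  -- is a walk from `x` back to `x` that may pass through the root once.
  cycle-block : ∀ c → IsCycle a c → Unique c →
                ∃ λ B → Bs [ blockOf c ]= B × All (InBlock (suc (blockOf c))) c
  cycle-block (x ∷ [])     (s≤s () , _) u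
  cycle-block (x ∷ z ∷ xs) (_ , e , w) (x∉ ∷ u) with x Fin.≟ root
  ... | yes refl with valid z (≢-sym (All.head x∉))
  ...   | B , i , eq = B , i , inj₁ refl ∷ All.map (λ p → inj₂ (trans p eq))
                         (walk-forward z xs (≢-sym (All.head x∉)) (All.map ≢-sym (All.tail x∉)) w)
  cycle-block (x ∷ z ∷ xs) (_ , e , w) (x∉ ∷ u) | no x≢ with valid x x≢
  ...   | B , i , eq = B , i , inj₂ eq ∷ subst (λ b → All (InBlock b) (z ∷ xs)) eq
                         (walk-through x (z ∷ xs) x≢ x≢ refl u (e , w))

  core? : Decidable (λ v → core v ≡ true)
  core? v = core v Bool.≟ true

  cores : List V → ℕ
  cores vs = length (filter core? vs)

  core-dec : ∀ v → core v ≡ true ⊎ core v ≡ false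
  core-dec v with core v
  ... | true  = inj₁ refl
  ... | false = inj₂ refl

  cores-≤ : ∀ v vs → cores vs ≤ cores (v ∷ vs)
  cores-≤ v vs with core v
  ... | true  = ℕ.n≤1+n _
  ... | false = ℕ.≤-refl

  cores-∷ : ∀ v vs {m} → core v ≡ true → m ≤ cores vs → suc m ≤ cores (v ∷ vs)
  cores-∷ v vs cv m≤ rewrite cv = s≤s m≤

  cores-edge : ∀ x y vs → a x y ≡ true → 1 ≤ cores (x ∷ y ∷ vs)
  cores-edge x y vs e with core-dec x
  ... | inj₁ cx  = cores-∷ x (y ∷ vs) cx z≤n
  ... | inj₂ ¬cx = ℕ.≤-trans (cores-∷ y vs (edge⇒core x y e ¬cx) z≤n) (cores-≤ x (y ∷ vs))

  cores-walk : ∀ x xs {y} → core y ≡ false → Walk a (x ∷ xs ++ y ∷ []) → 1 ≤ cores (x ∷ xs)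
  cores-walk x [] {y} ¬cy (e , _) with core-dec x
  ... | inj₁ cx  = cores-∷ x [] cx z≤n
  ... | inj₂ ¬cx = contradiction (trans (sym (edge⇒core x y e ¬cx)) ¬cy) λ ()
  cores-walk x (z ∷ xs) ¬cy (e , w) = ℕ.≤-trans (cores-walk z xs ¬cy w) (cores-≤ x (z ∷ xs))

  -- No edge joins two vertices outside the core. If `x` is in the core, the edge from `y` to `z`
  -- supplies a second core vertex. Otherwise `y` is in the core, and the walk from `z` back to `x`
  -- meets the core again before it ends.
  cycle-cores : ∀ c → IsCycle a c → 2 ≤ cores c
  cycle-cores (x ∷ y ∷ z ∷ vs) (_ , e , e′ , w) with core-dec x
  ... | inj₁ cx  = cores-∷ x (y ∷ z ∷ vs) cx (cores-edge y z vs e′)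
  ... | inj₂ ¬cx = ℕ.≤-trans (cores-∷ y (z ∷ vs) (edge⇒core x y e ¬cx) (cores-walk z vs ¬cx w))
                     (cores-≤ x (y ∷ z ∷ vs))
  cycle-cores (x ∷ [])     (s≤s () , _)
  cycle-cores (x ∷ y ∷ []) (s≤s (s≤s ()) , _)

  length-class-block : ∀ p {y B} → Bs [ y ]= B → length (class (suc y , p)) ≡ classSize p B
  length-class-block p {y} i = trans (length-class (suc y , p)) (count-layout p i)

  inClass : ∀ {v l} → lab v ≡ l → v ∈ class l
  inClass {v} refl = ∈-class v

  -- In a join each cycle uses two of the 2t + 1 core vertices. In a clique each cycle uses three of
  -- the 3t + 2 vertices, the root included. Both leave no room for t + 1 cycles.
  block-bound : ∀ cs → All (IsCycle a) cs → Unique (concat cs) → ∀ {y B} → Bs [ y ]= B →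
                length (filter (ℕ._≟ y) (map blockOf cs)) ≤ capacity B
  block-bound cs cyc u {y} {join t s} i = s≤s⁻¹ (ℕ.*-cancelʳ-< 2 N (suc t) (begin-strict
    N * 2                               ≤⟨ weigh coreOf? blockOf 2 y (All.zipWith heavy (cyc , concat-Unique⁻ cs u)) ⟩
    length (filter coreOf? (concat cs)) ≤⟨ Unique-⊆⇒length≤ (Unique.filter⁺ coreOf? u)
                                             (λ v∈ → inClass (proj₂ (∈-filter⁻ coreOf? {xs = concat cs} v∈))) ⟩
    length (class (suc y , true))       ≡⟨ length-class-block true i ⟩
    suc (t + t)                         <⟨ ℕ.≤-reflexive (arith t) ⟩
    suc t * 2                           ∎))
    where
    open ℕ.≤-Reasoning
    N = length (filter (ℕ._≟ y) (map blockOf cs))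
    coreOf? : Decidable (λ v → lab v ≡ (suc y , true))
    coreOf? v = lab v ≟ᴸ (suc y , true)
    heavy : ∀ {c} → IsCycle a c × Unique c → blockOf c ≡ y → 2 ≤ length (filter coreOf? c)
    heavy {c} (cyc , u) refl = ℕ.≤-trans (cycle-cores c cyc)
      (length-filter-mono core? coreOf? (All.map core⇒coreOf (proj₂ (proj₂ (cycle-block c cyc u)))))
      where
      core⇒coreOf : ∀ {v} → InBlock (suc y) v → core v ≡ true → lab v ≡ (suc y , true)
      core⇒coreOf (inj₁ refl) ()
      core⇒coreOf (inj₂ eq) cv = cong₂ _,_ eq cv
    arith : ∀ t → suc (suc (t + t)) ≡ suc t * 2
    arith = solve-∀
  block-bound cs cyc u {y} {clique t} i = s≤s⁻¹ (ℕ.*-cancelʳ-< 3 N (suc t) (begin-strict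
    N * 3                                ≤⟨ weigh inside? blockOf 3 y (All.zipWith heavy (cyc , concat-Unique⁻ cs u)) ⟩
    length (filter inside? (concat cs))  ≤⟨ Unique-⊆⇒length≤ (Unique.filter⁺ inside? u)
                                              (λ v∈ → sub (proj₂ (∈-filter⁻ inside? {xs = concat cs} v∈))) ⟩
    suc (length (class (suc y , true)))  ≡⟨ cong suc (length-class-block true i) ⟩
    suc (suc (t + t + t))                <⟨ ℕ.≤-reflexive (arith t) ⟩
    suc t * 3                            ∎))
    where
    open ℕ.≤-Reasoning
    N = length (filter (ℕ._≟ y) (map blockOf cs))
    inside? : Decidable (λ v → v ≡ root ⊎ lab v ≡ (suc y , true))
    inside? v = (v Fin.≟ root) ⊎-dec (lab v ≟ᴸ (suc y , true))
    sub : ∀ {v} → v ≡ root ⊎ lab v ≡ (suc y , true) → v ∈ root ∷ class (suc y , true)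
    sub (inj₁ v≡root) = here v≡root
    sub {v} (inj₂ eq) = there (inClass {v} eq)
    noIndep : ∀ {v} → lab v ≢ (suc y , false)
    noIndep {v} eq with class (suc y , false) | length-class-block false i | inClass {v} eq
    ... | []    | _ | ()
    ... | _ ∷ _ | () | _
    clique-label : ∀ {v} → InBlock (suc y) v → v ≡ root ⊎ lab v ≡ (suc y , true)
    clique-label (inj₁ v≡root) = inj₁ v≡root
    clique-label {v} (inj₂ eq) with core-dec v
    ... | inj₁ cv  = inj₂ (cong₂ _,_ eq cv)
    ... | inj₂ ¬cv = contradiction (cong₂ _,_ eq ¬cv) (noIndep {v})
    heavy : ∀ {c} → IsCycle a c × Unique c → blockOf c ≡ y → 3 ≤ length (filter inside? c)
    heavy {x ∷ xs} (cyc , u) refl = ℕ.≤-trans (proj₁ cyc) (ℕ.≤-reflexive (cong length (sym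
      (filter-all inside? (All.map (λ {v} → clique-label {v}) (proj₂ (proj₂ (cycle-block (x ∷ xs) cyc u))))))))
    arith : ∀ t → suc (suc (suc (t + t + t))) ≡ suc t * 3
    arith = solve-∀

  cycles≤capacity : ∀ {k} → HasKCycles k a → k ≤ totalCapacity Bs
  cycles≤capacity (cs , refl , cyc , u) = ℕ.≤-trans (ℕ.≤-reflexive (sym (length-map blockOf cs)))
    (capacity-bound Bs (map blockOf cs) (All.map⁺ (All.zipWith block (cyc , concat-Unique⁻ cs u)))
      (block-bound cs cyc u))
    where
    block : ∀ {c} → IsCycle a c × Unique c → ∃ λ B → Bs [ blockOf c ]= B
    block {c} (cyc , u) = let B , i , _ = cycle-block c cyc u in B , i

-- Adding an edge creates one more cycle

module _ {n} {a a′ : Adj n} (a⊆a′ : ∀ {u v} → a u v ≡ true → a′ u v ≡ true) where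

  Walk-mono : ∀ xs → Walk a xs → Walk a′ xs
  Walk-mono []           w       = _
  Walk-mono (x ∷ [])     w       = _
  Walk-mono (x ∷ y ∷ xs) (e , w) = a⊆a′ e , Walk-mono (y ∷ xs) w

  IsCycle-mono : ∀ {xs} → IsCycle a xs → IsCycle a′ xs
  IsCycle-mono {x ∷ xs} (3≤ , w) = 3≤ , Walk-mono (x ∷ xs ++ x ∷ []) w

Walk-join : ∀ {n} {a : Adj n} xs u {v ys} → Walk a (xs ++ u ∷ []) → a u v ≡ true → Walk a (v ∷ ys) →
            Walk a ((xs ++ u ∷ []) ++ v ∷ ys)
Walk-join []           u w       e w′ = e , w′
Walk-join (x ∷ [])     u (e₁ , w) e w′ = e₁ , e , w′
Walk-join (x ∷ z ∷ xs) u (e₁ , w) e w′ = e₁ , Walk-join (z ∷ xs) u w e w′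

addEdge-⊆ : ∀ {n} (a : Adj n) u v {x y} → a x y ≡ true → addEdge a u v x y ≡ true
addEdge-⊆ a u v e rewrite e = refl

≟-refl : ∀ {n} (u : Fin n) → ⌊ u Fin.≟ u ⌋ ≡ true
≟-refl u with u Fin.≟ u
... | yes _   = refl
... | no  u≢u = contradiction refl u≢u

addEdge-new : ∀ {n} (a : Adj n) u v → addEdge a u v u v ≡ true
addEdge-new a u v rewrite ≟-refl u | ≟-refl v = Bool.∨-zeroʳ (a u v)

Packing : ∀ {n} → Adj n → (Fin n → Set) → ℕ → Set
Packing a Q t = ∃ λ cs → length cs ≡ t × All (IsCycle a) cs × Unique (concat cs) ×
                (∀ {v} → v ∈ concat cs → Q v)

-- `Q y` marks the vertices reserved for block `y`. No vertex carries two marks, so the packings of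
-- different blocks are disjoint.
packing-union : ∀ {n} {a : Adj n} Cs (Q : ℕ → Fin n → Set) → (∀ {y y′ v} → Q y v → Q y′ v → y ≡ y′) →
                (∀ {y B} → Cs [ y ]= B → Packing a (Q y) (capacity B)) →
                Packing a (λ v → ∃ λ y → Q y v) (totalCapacity Cs)
packing-union []       Q disj pack = [] , refl , [] , [] , λ ()
packing-union {a = a} (B ∷ Cs) Q disj pack
  with pack here
     | packing-union {a = a} Cs (Q ∘ suc) (λ q q′ → ℕ.suc-injective (disj q q′)) (pack ∘ there)
... | xs , len , cxs , uxs , qxs | ys , eq , cys , uys , qys =
  xs ++ ys , trans (length-++ xs) (cong₂ _+_ len eq) , All.++⁺ cxs cys ,
  subst Unique (concat-++ xs ys) (Unique.++⁺ uxs uys disjoint) , member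
  where
  disjoint : ∀ {v} → ¬ (v ∈ concat xs × v ∈ concat ys)
  disjoint (v∈xs , v∈ys) = contradiction (disj (qxs v∈xs) (proj₂ (qys v∈ys))) λ ()
  member : ∀ {v} → v ∈ concat (xs ++ ys) → ∃ λ y → Q y v
  member {v} v∈ with ∈-++⁻ (concat xs) (subst (v ∈_) (sym (concat-++ xs ys)) v∈)
  ... | inj₁ v∈xs = 0 , qxs v∈xs
  ... | inj₂ v∈ys = let y , q = qys v∈ys in suc y , q

module Saturation (Bs : List Block) where
  open BlockGraph Bs

  a-sym : ∀ u v → a u v ≡ a v u
  a-sym = adj-sym (blockGraph Bs)

  adjacent : ∀ {u v} → u ≢ v → core u ≡ true → meets (blk u) (blk v) ≡ true → a u v ≡ true
  adjacent {u} {v} u≢v cu m with u Fin.≟ v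
  ... | yes u≡v = contradiction u≡v u≢v
  ... | no  _   = cong₂ _∧_ (cong (_∨ core v) cu) m

  meets-refl : ∀ x → meets x x ≡ true
  meets-refl zero    = refl
  meets-refl (suc zero)    = refl
  meets-refl (suc (suc x)) = meets-refl (suc x)

  -- The root may be lent to one block b, where it acts as one more independent vertex.
  Near : ℕ → ℕ → V → Set
  Near b y v = blk v ≡ suc y ⊎ (v ≡ root × y ≡ b)

  Near-unique : ∀ {b y y′ v} → Near b y v → Near b y′ v → y ≡ y′
  Near-unique (inj₁ eq)         (inj₁ eq′)        = ℕ.suc-injective (trans (sym eq) eq′)
  Near-unique (inj₁ eq)         (inj₂ (refl , _)) = contradiction eq λ ()
  Near-unique (inj₂ (refl , _)) (inj₁ eq)         = contradiction eq λ ()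
  Near-unique (inj₂ (_ , refl)) (inj₂ (_ , refl)) = refl

  near-adjacent : ∀ {b y u v} → lab u ≡ (suc y , true) → Near b y v → u ≢ v → a u v ≡ true
  near-adjacent {y = y} {u} {v} lu near u≢v = adjacent u≢v (cong proj₂ lu) (meet near)
    where
    meet : Near _ y v → meets (blk u) (blk v) ≡ true
    meet (inj₁ eq)         = trans (cong₂ meets (cong proj₁ lu) eq) (meets-refl (suc y))
    meet (inj₂ (refl , _)) = cong (λ x → meets x 0) (cong proj₁ lu)

  ∈-avoiding : ∀ (R : List V) {xs v} → v ∈ avoiding Fin._≟_ R xs → v ∈ xs × v ∉ R
  ∈-avoiding R {xs} = ∈-filter⁻ _ {xs = xs}

  -- Enough third vertices for the triangles outside `R`. This is asked of joins alone, since a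
  -- clique packs its triangles inside its core.
  Available : ℕ → List V → ℕ → Set
  Available b R y = ∀ {t s} → Bs [ y ]= join t s → ∃ λ ys → Unique ys × All (Near b y) ys ×
                    All (λ v → core v ≡ false) ys × t ≤ length (avoiding Fin._≟_ R ys)

  -- `R` will be the cycle through the new edge, and `c` holds what it takes from the core of this
  -- block. Losing at most one core vertex leaves 2t of them in a join and 3t in a clique, enough
  -- for t triangles.
  block-packing : ∀ {b y B} R c → Bs [ y ]= B →
                  (∀ {v} → v ∈ R → lab v ≡ (suc y , true) → v ∈ c) → length c ≤ 1 →
                  Available b R y →
                  Packing a (λ v → Near b y v × v ∉ R) (capacity B)
  block-packing {b} {y} {B} R c i covers c≤1 available = go B i available
    where
    Core Third : V → Set
    Core  v = lab v ≡ (suc y , true) × v ∉ R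
    Third v = Near b y v × v ∉ R
    Core⇒Third : ∀ {v} → Core v → Third v
    Core⇒Third (lv , v∉R) = inj₁ (cong proj₁ lv) , v∉R
    edge : ∀ {u v} → Core u → Third v → u ≢ v → a u v ≡ true
    edge {u} {v} (lu , _) (near , _) = near-adjacent {u = u} {v} lu near
    pack : ∀ t xs ys → All Core xs → All Third ys → Unique (xs ++ ys) →
           t + t ≤ length xs → t ≤ length ys → Packing a Third t
    pack t xs ys pxs qys u 2t≤ t≤ =
      let cs , len , cyc , ucs , sub = triangles a-sym {P = Core} {Q = Third} (λ {v} → Core⇒Third {v}) (λ {u} {v} → edge {u} {v}) t xs ys pxs qys u 2t≤ t≤
      in cs , len , cyc , ucs , λ v∈ → All.lookup (All.++⁺ (All.map (λ {v} → Core⇒Third {v}) pxs) qys) (sub v∈)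

    cs = avoiding Fin._≟_ R (class (suc y , true))
    cs-core : All Core cs
    cs-core = All.tabulate λ v∈ →
      let v∈c , v∉R = ∈-avoiding R {class (suc y , true)} v∈ in class-lab (suc y , true) v∈c , v∉R
    cs-unique : Unique cs
    cs-unique = Unique.filter⁺ _ (class-unique (suc y , true))
    coreSize≤ : ∀ {B} → Bs [ y ]= B → coreSize B ≤ suc (length cs)
    coreSize≤ {B} i = begin
      coreSize B                    ≡⟨ sym (length-class-block true i) ⟩
      length (class (suc y , true)) ≤⟨ length-avoiding Fin._≟_ R c (class-unique (suc y , true))
                                         (λ v∈R v∈ → covers v∈R (class-lab (suc y , true) v∈)) ⟩
      length cs + length c          ≤⟨ ℕ.+-monoʳ-≤ (length cs) c≤1 ⟩
      length cs + 1                 ≡⟨ ℕ.+-comm (length cs) 1 ⟩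
      suc (length cs)               ∎
      where open ℕ.≤-Reasoning

    go : ∀ B → Bs [ y ]= B → Available b R y → Packing a Third (capacity B)
    -- The first 2t remaining core vertices form the pairs, and the others, at least t, are the
    -- third vertices.
    go (clique t) i _ = pack t (take (t + t) cs) (drop (t + t) cs)
      (All.take⁺ (t + t) cs-core) (All.map (λ {v} → Core⇒Third {v}) (All.drop⁺ (t + t) cs-core))
      (subst Unique (sym (take++drop≡id (t + t) cs)) cs-unique)
      (ℕ.≤-reflexive (sym (trans (length-take (t + t) cs) (ℕ.m≤n⇒m⊓n≡m (ℕ.≤-trans (ℕ.m≤m+n (t + t) t) 3t≤)))))
      (ℕ.≤-trans (ℕ.≤-reflexive (sym (ℕ.m+n∸m≡n (t + t) t)))
        (ℕ.≤-trans (ℕ.∸-monoˡ-≤ (t + t) 3t≤) (ℕ.≤-reflexive (sym (length-drop (t + t) cs)))))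
      where
      3t≤ : t + t + t ≤ length cs
      3t≤ = s≤s⁻¹ (coreSize≤ i)
    go (join t s) i available with available i
    ... | ys , uys , near , noncore , t≤ = pack t cs (avoiding Fin._≟_ R ys) cs-core
      (All.tabulate λ v∈ → let v∈ys , v∉R = ∈-avoiding R {ys} v∈ in All.lookup near v∈ys , v∉R)
      (Unique.++⁺ cs-unique (Unique.filter⁺ _ uys) disjoint)
      (s≤s⁻¹ (coreSize≤ i)) t≤
      where
      disjoint : ∀ {v} → ¬ (v ∈ cs × v ∈ avoiding Fin._≟_ R ys)
      disjoint {v} (v∈cs , v∈ys) = contradiction
        (trans (sym (cong proj₂ (class-lab (suc y , true) (proj₁ (∈-avoiding R {class (suc y , true)} v∈cs)))))
               (All.lookup noncore (proj₁ (∈-avoiding R {ys} v∈ys)))) λ ()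

  -- `R` is the one cycle beyond the full packings of the blocks, which all avoid it.
  extend : ∀ {b} u v R → IsCycle (addEdge a u v) R → Unique R →
           (∀ {y B} → Bs [ y ]= B → Packing a (λ w → Near b y w × w ∉ R) (capacity B)) →
           HasKCycles (suc (totalCapacity Bs)) (addEdge a u v)
  extend {b} u v R cycR uR pack
    with packing-union {a = a} Bs (λ y w → Near b y w × w ∉ R)
           (λ { {v = v} (q , _) (q′ , _) → Near-unique {v = v} q q′}) pack
  ... | cs , eq , cyc , ucs , sub =
    R ∷ cs , cong suc eq , cycR ∷ All.map (IsCycle-mono (λ {x} {y} → addEdge-⊆ a u v {x} {y})) cyc ,
    Unique.++⁺ uR ucs λ { (v∈R , v∈cs) → proj₂ (proj₂ (sub v∈cs)) v∈R }

  someCore : ∀ {y B} → Bs [ y ]= B → ∃ λ c → lab c ≡ (suc y , true)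
  someCore {y} {B} i with class (suc y , true) | length-class-block true i | (λ {v} → class-lab (suc y , true) {v})
  ... | c ∷ _ | _   | f = c , f (here refl)
  ... | []    | len | _ with B
  ...   | clique t = contradiction len λ ()
  ...   | join t s = contradiction len λ ()

  core≢ : ∀ {c w y} → lab c ≡ (suc y , true) → core w ≡ false → c ≢ w
  core≢ lc ¬cw refl = contradiction (trans (sym (cong proj₂ lc)) ¬cw) λ ()

  indep-near : ∀ {b} y → All (Near b y) (class (suc y , false))
  indep-near y = All.tabulate λ v∈ → inj₁ (cong proj₁ (class-lab (suc y , false) v∈))

  indep-noncore : ∀ y → All (λ v → core v ≡ false) (class (suc y , false))
  indep-noncore y = All.tabulate λ v∈ → cong proj₂ (class-lab (suc y , false) v∈)

  -- The new edge closes a triangle with any core vertex `c` of the block. Together with the root, a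
  -- join has t + s + 2 independent vertices, so t remain after `u` and `v` are taken, whether or
  -- not one of these is the root.
  saturated-within : ∀ {y B} u v → u ≢ v → Bs [ y ]= B → Near y y u → Near y y v →
                     core u ≡ false → core v ≡ false →
                     HasKCycles (suc (totalCapacity Bs)) (addEdge a u v)
  saturated-within {y} {B} u v u≢v i nu nv ¬cu ¬cv =
    extend {y} u v R cycle unique λ i′ → block-packing R (c ∷ []) i′ (covers _) (s≤s z≤n) (available _)
    where
    c = proj₁ (someCore i)
    lc : lab c ≡ (suc y , true)
    lc = proj₂ (someCore i)
    c≢u = core≢ {c} {u} lc ¬cu
    c≢v = core≢ {c} {v} lc ¬cv
    R = c ∷ u ∷ v ∷ []
    cycle : IsCycle (addEdge a u v) R
    cycle = s≤s (s≤s (s≤s z≤n)) ,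
            addEdge-⊆ a u v {c} {u} (near-adjacent {u = c} {u} lc nu c≢u) ,
            addEdge-new a u v ,
            addEdge-⊆ a u v {v} {c} (trans (a-sym v c) (near-adjacent {u = c} {v} lc nv c≢v)) , _
    unique : Unique R
    unique = (c≢u ∷ c≢v ∷ []) ∷ (u≢v ∷ []) ∷ [] ∷ []
    covers : ∀ y′ {w} → w ∈ R → lab w ≡ (suc y′ , true) → w ∈ c ∷ []
    covers y′ (here w≡c)                  lw = here w≡c
    covers y′ (there (here refl))         lw = contradiction (trans (sym (cong proj₂ lw)) ¬cu) λ ()
    covers y′ (there (there (here refl))) lw = contradiction (trans (sym (cong proj₂ lw)) ¬cv) λ ()
    near : ∀ {w} → w ∈ R → Near y y w
    near (here refl)                 = inj₁ (cong proj₁ lc)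
    near (there (here refl))         = nu
    near (there (there (here refl))) = nv
    available : ∀ y′ → Available y R y′
    available y′ {t} {s} j with y′ ℕ.≟ y
    ... | yes refl = ys , root∉ ∷ class-unique _ , inj₂ (refl , refl) ∷ indep-near y , refl ∷ indep-noncore y ,
      ℕ.+-cancelʳ-≤ 2 t _ (ℕ.≤-trans long (length-avoiding Fin._≟_ R (u ∷ v ∷ []) (root∉ ∷ class-unique _) meet))
      where
      ys = root ∷ class (suc y , false)
      root∉ : All (root ≢_) (class (suc y , false))
      root∉ = All.tabulate λ { v∈ refl → contradiction (cong proj₁ (class-lab (suc y , false) v∈)) λ () }
      long : t + 2 ≤ length ys
      long = ℕ.≤-trans (ℕ.≤-reflexive (ℕ.+-comm t 2))
        (s≤s (ℕ.≤-trans (s≤s (ℕ.m≤m+n t s)) (ℕ.≤-reflexive (sym (length-class-block false j)))))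
      meet : ∀ {w} → w ∈ R → w ∈ ys → w ∈ u ∷ v ∷ []
      meet (here refl) (here c≡root) = contradiction (trans (sym (cong proj₁ lc)) (cong blk c≡root)) λ ()
      meet (here refl) (there c∈)    = contradiction (trans (sym (cong proj₂ lc)) (All.lookup (indep-noncore y) c∈)) λ ()
      meet (there w∈)  _             = w∈
    -- `R` lies near `y`, so every other block keeps all its independent vertices.
    ... | no y′≢y = ys , class-unique _ , indep-near y′ , indep-noncore y′ ,
      ℕ.≤-trans long (ℕ.≤-trans (length-avoiding Fin._≟_ R [] (class-unique _) meet) (ℕ.≤-reflexive (ℕ.+-identityʳ _)))
      where
      ys = class (suc y′ , false)
      long : t ≤ length ys
      long = ℕ.≤-trans (ℕ.≤-trans (ℕ.m≤m+n t s) (ℕ.n≤1+n _)) (ℕ.≤-reflexive (sym (length-class-block false j)))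
      meet : ∀ {w} → w ∈ R → w ∈ ys → w ∈ []
      meet {w} w∈R w∈ = contradiction (Near-unique {v = w} (All.lookup (indep-near y′) w∈) (near w∈R)) y′≢y

  -- Distinct labels on R mean that R takes at most one core and one independent vertex from every block.
  extend-distinct : ∀ u v R → IsCycle (addEdge a u v) R → Unique (map lab R) →
                    HasKCycles (suc (totalCapacity Bs)) (addEdge a u v)
  extend-distinct u v R cycle distinct =
    -- The value 0 is arbitrary: all packings are drawn from the classes of the blocks, so none of
    -- them uses the root.
    extend {0} u v R cycle (Unique.map⁻ distinct) λ {y} i →
      block-packing R (of (suc y , true)) i (λ w∈ lw → ∈-of (suc y , true) w∈ lw) (of≤1 (suc y , true))
        λ j → class (suc y , false) , class-unique _ , indep-near y , indep-noncore y , enough j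
    where
    open ℕ.≤-Reasoning
    of : Label → List V
    of l = filter (λ w → lab w ≟ᴸ l) R
    ∈-of : ∀ l {w} → w ∈ R → lab w ≡ l → w ∈ of l
    ∈-of l = ∈-filter⁺ (λ w → lab w ≟ᴸ l)
    of≤1 : ∀ l → length (of l) ≤ 1
    of≤1 l = go R distinct
      where
      none : ∀ ws → All (l ≢_) (map lab ws) → filter (λ w → lab w ≟ᴸ l) ws ≡ []
      none []       []       = refl
      none (w ∷ ws) (l≢ ∷ l∉) with lab w ≟ᴸ l
      ... | yes eq = contradiction (sym eq) l≢
      ... | no  _  = none ws l∉
      go : ∀ ws → Unique (map lab ws) → length (filter (λ w → lab w ≟ᴸ l) ws) ≤ 1
      go []       _        = z≤n
      go (w ∷ ws) (w∉ ∷ u) with lab w ≟ᴸ l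
      ... | no  _    = go ws u
      ... | yes refl = s≤s (ℕ.≤-reflexive (cong length (none ws w∉)))
    enough : ∀ {y t s} → Bs [ y ]= join t s → t ≤ length (avoiding Fin._≟_ R (class (suc y , false)))
    enough {y} {t} {s} j = s≤s⁻¹ (begin
      suc t                                     ≤⟨ s≤s (ℕ.m≤m+n t s) ⟩
      suc (t + s)                               ≡⟨ sym (length-class-block false j) ⟩
      length (class (suc y , false))            ≤⟨ length-avoiding Fin._≟_ R (of (suc y , false)) (class-unique _)
                                                     (λ w∈ w∈c → ∈-of (suc y , false) w∈ (class-lab _ w∈c)) ⟩
      length left + length (of (suc y , false)) ≤⟨ ℕ.+-monoʳ-≤ (length left) (of≤1 (suc y , false)) ⟩
      length left + 1                           ≡⟨ ℕ.+-comm (length left) 1 ⟩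
      suc (length left)                         ∎)
      where left = avoiding Fin._≟_ R (class (suc y , false))

  coreOf : ∀ {v} → v ≢ root → ∃ λ c → lab c ≡ (blk v , true)
  coreOf {v} v≢ with valid v v≢
  ... | B , i , eq with someCore i
  ...   | c , lc = c , trans lc (cong (_, true) (sym eq))

  meets-root : ∀ x → meets x 0 ≡ true
  meets-root zero    = refl
  meets-root (suc x) = refl

  core-root-edge : ∀ {c} → core c ≡ true → a c root ≡ true
  core-root-edge {c} cc = adjacent {c} {root} (λ { refl → contradiction cc λ () }) cc (meets-root (blk c))

  core-block-edge : ∀ {c u} → lab c ≡ (blk u , true) → core u ≡ false → a c u ≡ true
  core-block-edge {c} {u} lc ¬cu = adjacent {c} {u} (λ { refl → contradiction (trans (sym (cong proj₂ lc)) ¬cu) λ () })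
    (cong proj₂ lc) (trans (cong (λ x → meets x (blk u)) (cong proj₁ lc)) (meets-refl (blk u)))

  -- One half of the cycle closed by an edge between two blocks: from `v` to the root, directly if
  -- `v` is in the core and through some core vertex of its block otherwise. `outward` takes the
  -- continuation as an argument so that walks can be composed.
  record Exit (v : V) : Set where
    field
      path     : List V
      inside   : All (λ w → blk w ≡ blk v) (v ∷ path)
      distinct : Unique (map lab (v ∷ path))
      outward  : ∀ rest → Walk a (root ∷ rest) → Walk a (v ∷ path ++ root ∷ rest)

  exit : ∀ v → v ≢ root → Exit v
  exit v v≢ with core-dec v
  ... | inj₁ cv  = record
    { path     = []
    ; inside   = refl ∷ []
    ; distinct = [] ∷ []
    ; outward  = λ rest w → core-root-edge {v} cv , w
    }
  ... | inj₂ ¬cv with coreOf {v} v≢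
  ...   | c , lc = record
    { path     = c ∷ []
    ; inside   = refl ∷ cong proj₁ lc ∷ []
    ; distinct = ((λ eq → contradiction (trans (sym ¬cv) (trans (cong proj₂ eq) (cong proj₂ lc))) λ ()) ∷ []) ∷ [] ∷ []
    ; outward  = λ rest w → trans (a-sym v c) (core-block-edge {c} {v} lc ¬cv) , core-root-edge {c} (cong proj₂ lc) , w
    }

  record Entrance (u : V) : Set where
    field
      path     : List V
      inside   : All (λ w → blk w ≡ blk u) (path ++ u ∷ [])
      distinct : Unique (map lab (path ++ u ∷ []))
      inward   : Walk a (root ∷ path ++ u ∷ [])

  entrance : ∀ u → u ≢ root → Entrance u
  entrance u u≢ with core-dec u
  ... | inj₁ cu  = record
    { path     = []
    ; inside   = refl ∷ []
    ; distinct = [] ∷ []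
    ; inward   = trans (a-sym root u) (core-root-edge {u} cu) , _
    }
  ... | inj₂ ¬cu with coreOf {u} u≢
  ...   | c , lc = record
    { path     = c ∷ []
    ; inside   = cong proj₁ lc ∷ refl ∷ []
    ; distinct = ((λ eq → contradiction (trans (sym ¬cu) (trans (sym (cong proj₂ eq)) (cong proj₂ lc))) λ ()) ∷ []) ∷ [] ∷ []
    ; inward   = trans (a-sym root c) (core-root-edge {c} (cong proj₂ lc)) , core-block-edge {c} {u} lc ¬cu , _
    }

  -- The cycle leads from the root to `u`, over the new edge to `v`, and back to the root. Labels
  -- differ inside each half by construction and between the halves by their block numbers.
  saturated-between : ∀ u v → u ≢ root → v ≢ root → blk u ≢ blk v →
                      HasKCycles (suc (totalCapacity Bs)) (addEdge a u v)
  saturated-between u v u≢ v≢ bu≢bv = extend-distinct u v R (3≤ , walk) distinct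
    where
    open Entrance (entrance u u≢) renaming (path to p; inside to p-in; distinct to p-distinct)
    open Exit (exit v v≢) renaming (path to q; inside to q-in; distinct to q-distinct)
    a′ = addEdge a u v
    P = p ++ u ∷ []
    Q = v ∷ q
    R = root ∷ P ++ Q
    mono : ∀ {x y} → a x y ≡ true → a′ x y ≡ true
    mono {x} {y} = addEdge-⊆ a u v {x} {y}
    walk : Walk a′ (R ++ root ∷ [])
    walk = subst (Walk a′) (cong (root ∷_) (sym (++-assoc P Q (root ∷ []))))
      (Walk-join (root ∷ p) u (Walk-mono (λ {x} {y} → mono {x} {y}) (root ∷ P) inward) (addEdge-new a u v)
        (Walk-mono (λ {x} {y} → mono {x} {y}) (Q ++ root ∷ []) (outward [] _)))
    3≤ : 3 ≤ length R
    3≤ = s≤s (ℕ.≤-trans (ℕ.+-mono-≤ {1} {length P} {1} {length Q}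
                (ℕ.≤-trans (ℕ.m≤n+m 1 (length p)) (ℕ.≤-reflexive (sym (length-++ p)))) (s≤s z≤n))
              (ℕ.≤-reflexive (sym (length-++ P))))
    blk-label : ∀ {b ws l} → All (λ w → blk w ≡ b) ws → l ∈ map lab ws → proj₁ l ≡ b
    blk-label eqs l∈ with ∈-map⁻ lab l∈
    ... | w , w∈ , refl = All.lookup eqs w∈
    away : ∀ {w ws} → w ≢ root → All (λ x → blk x ≡ blk w) ws → All ((0 , false) ≢_) (map lab ws)
    away {w} w≢ eqs = All.tabulate λ { l∈ refl → w≢ (blk≡0⇒root w (sym (blk-label eqs l∈))) }
    distinct : Unique (map lab R)
    distinct = subst (λ ls → Unique ((0 , false) ∷ ls)) (sym (map-++ lab P Q))
      (All.++⁺ (away {u} {P} u≢ p-in) (away {v} {Q} v≢ q-in) ∷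
       Unique.++⁺ p-distinct q-distinct
         λ { (l∈P , l∈Q) → bu≢bv (trans (sym (blk-label p-in l∈P)) (blk-label q-in l∈Q)) })

  addEdge-saturated : ∀ u v → u ≢ v → a u v ≡ false →
                      HasKCycles (suc (totalCapacity Bs)) (addEdge a u v)
  addEdge-saturated u v u≢v ¬e with meets (blk u) (blk v) Bool.≟ true
  ... | no ¬m = saturated-between u v
    (λ { refl → ¬m refl }) (λ { refl → ¬m (meets-root (blk u)) })
    (λ eq → ¬m (trans (cong (meets (blk u)) (sym eq)) (meets-refl (blk u))))
  -- The block numbers meet, so the missing edge forces both ends to be outside the core.
  ... | yes m with core-dec u | core-dec v
  ...   | inj₁ cu  | _        = contradiction (trans (sym ¬e) (adjacent {u} {v} u≢v cu m)) λ ()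
  ...   | inj₂ _   | inj₁ cv  = contradiction
    (trans (sym ¬e) (trans (a-sym u v) (adjacent {v} {u} (≢-sym u≢v) cv (trans (meets-sym (blk v) (blk u)) m)))) λ ()
  ...   | inj₂ ¬cu | inj₂ ¬cv with u Fin.≟ root | v Fin.≟ root
  ...     | yes refl | yes refl = contradiction refl u≢v
  ...     | yes refl | no  v≢   = let B , i , eq = valid v v≢ in
    saturated-within u v u≢v i (inj₂ (refl , refl)) (inj₁ eq) ¬cu ¬cv
  ...     | no  u≢   | yes refl = let B , i , eq = valid u u≢ in
    saturated-within u v u≢v i (inj₁ eq) (inj₂ (refl , refl)) ¬cu ¬cv
  ...     | no  u≢   | no  v≢   with meets⇒ (blk u) (blk v) m
  ...       | inj₁ eq        = contradiction (blk≡0⇒root u eq) u≢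
  ...       | inj₂ (inj₁ eq) = contradiction (blk≡0⇒root v eq) v≢
  ...       | inj₂ (inj₂ same) = let B , i , eq = valid u u≢ in
    saturated-within u v u≢v i (inj₁ eq) (inj₁ (trans (sym same) eq)) ¬cu ¬cv

  blockGraph-saturated : Saturated (suc (totalCapacity Bs)) (blockGraph Bs)
  blockGraph-saturated = (λ h → ℕ.1+n≰n (cycles≤capacity h)) , addEdge-saturated

-- Orders and sizes of the constructed graphs

-- `σ` does not count the root, while `e` does include the edges at the root.
record Profile (Bs : List Block) (t σ e : ℕ) : Set where
  constructor profile
  field
    capacity≡ : totalCapacity Bs ≡ t
    size≡     : sum (map blockSize Bs) ≡ σ
    edges≡    : sum (map blockEdges Bs) ≡ e

profile-++ : ∀ {Bs Cs t t′ σ σ′ e e′} → Profile Bs t σ e → Profile Cs t′ σ′ e′ →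
             Profile (Bs ++ Cs) (t + t′) (σ + σ′) (e + e′)
profile-++ {Bs} {Cs} (profile refl refl refl) (profile refl refl refl) =
  profile (split capacity) (split blockSize) (split blockEdges)
  where
  split : ∀ f → sum (map f (Bs ++ Cs)) ≡ sum (map f Bs) + sum (map f Cs)
  split f = trans (cong sum (map-++ f Bs Cs)) (sum-++ (map f Bs) (map f Cs))

profile-replicate : ∀ h B → Profile (replicate h B) (h * capacity B) (h * blockSize B) (h * blockEdges B)
profile-replicate h B = profile (times h capacity) (times h blockSize) (times h blockEdges)
  where
  times : ∀ h f → sum (map f (replicate h B)) ≡ h * f B
  times zero    f = refl
  times (suc h) f = cong (f B +_) (times h f)

realise : ∀ {Bs t σ e n k m} → Profile Bs t σ e → suc σ ≡ n → suc t ≡ k → e ≡ m → InES n k m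
realise {Bs} (profile refl refl refl) refl refl refl =
  subst (λ n → InES n (suc (totalCapacity Bs)) (sum (map blockEdges Bs))) (length-layout Bs)
    (blockGraph Bs , Saturation.blockGraph-saturated Bs , edgeCount-blockGraph Bs)

-- Glue `κ` complete graphs on five vertices at the root and attach `p` pendant vertices, which are
-- the blocks `clique 0`. For k = κ + 1 and n = 4κ + p + 1 this gives n + 6k - 7 edges.
minimal : ∀ κ p → InES (suc (4 * κ + p)) (suc κ) (10 * κ + p)
minimal κ p = realise (profile-++ (profile-replicate κ (clique 1)) (profile-replicate p (clique 0)))
  (size κ p) (caps κ p) (edges κ p)
  where
  size : ∀ κ p → suc (κ * 4 + p * 1) ≡ suc (4 * κ + p)
  size = solve-∀
  caps : ∀ κ p → suc (κ * 1 + p * 0) ≡ suc κ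
  caps = solve-∀
  edges : ∀ κ p → κ * 10 + p * 1 ≡ 10 * κ + p
  edges = solve-∀

parity : ∀ r → ∃ λ j → r ≡ j + j ⊎ r ≡ suc (j + j)
parity zero = 0 , inj₁ refl
parity (suc r) with parity r
... | j , inj₁ eq = j , inj₂ (cong suc eq)
... | j , inj₂ eq = suc j , inj₁ (cong suc (trans eq (sym (ℕ.+-suc j j))))

-- Edges exceed vertices by 6 in `clique 1` and by 7 + 2j in `join 1 j`. Two such blocks give 12, 13
-- + 2j and 14 + 2j, hence every excess from 12 on.
tuning : ∀ r → ∃ λ As → ∃ λ σ → Profile As 2 σ (σ + 12 + r) × σ + σ ≤ 18 + r
tuning zero = clique 1 ∷ clique 1 ∷ [] , 8 , profile refl refl refl , ℕ.m≤m+n 16 2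
tuning (suc r) with parity r
... | j , inj₁ refl = clique 1 ∷ join 1 j ∷ [] , 9 + j ,
  profile refl (size j) (edges j) , ℕ.≤-trans (ℕ.n≤1+n _) (ℕ.≤-reflexive (bound j))
  where
  size : ∀ j → 4 + (5 + j + 0) ≡ 9 + j
  size = solve-∀
  edges : ∀ j → 10 + (3 + (3 + 3 * (2 + j)) + 0) ≡ 9 + j + 12 + suc (j + j)
  edges = solve-∀
  bound : ∀ j → suc (9 + j + (9 + j)) ≡ 18 + suc (j + j)
  bound = solve-∀
... | j , inj₂ refl = join 1 0 ∷ join 1 j ∷ [] , 10 + j ,
  profile refl (size j) (edges j) , ℕ.≤-reflexive (bound j)
  where
  size : ∀ j → 5 + (5 + j + 0) ≡ 10 + j
  size = solve-∀
  edges : ∀ j → 12 + (3 + (3 + 3 * (2 + j)) + 0) ≡ 10 + j + 12 + suc (suc (j + j))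
  edges = solve-∀
  bound : ∀ j → 10 + j + (10 + j) ≡ 18 + suc (suc (j + j))
  bound = solve-∀

triangular-even : ∀ t → triangular (t + t) + t ≡ 2 * t * t
triangular-even zero    = refl
triangular-even (suc t) rewrite ℕ.+-suc t t =
  trans (shuffle t (triangular (t + t))) (trans (cong (_+ (4 * t + 2)) (triangular-even t)) (expand t))
  where
  shuffle : ∀ t T → suc (t + t) + (t + t + T) + suc t ≡ T + t + (4 * t + 2)
  shuffle = solve-∀
  expand : ∀ t → 2 * t * t + (4 * t + 2) ≡ 2 * suc t * suc t
  expand = solve-∀

blockEdges-join : ∀ t s → blockEdges (join t s) ≡ 2 + 6 * t + 4 * t * t + s + 2 * t * s
blockEdges-join t s = trans (shuffle t s (triangular (t + t)))
  (trans (cong (_+ (2 + 6 * t + 2 * t * t + s + 2 * t * s)) (triangular-even t)) (expand t s))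
  where
  shuffle : ∀ t s T → suc (t + t) + (t + t + T + suc (t + t) * suc (t + s)) ≡
                      T + t + (2 + 6 * t + 2 * t * t + s + 2 * t * s)
  shuffle = solve-∀
  expand : ∀ t s → 2 * t * t + (2 + 6 * t + 2 * t * t + s + 2 * t * s) ≡ 2 + 6 * t + 4 * t * t + s + 2 * t * s
  expand = solve-∀

-- Here k = 3 + t + h, and `D` is the surplus over n + 6k - 7 edges. The blocks are `join t s`, the
-- tuning pair for `r`, `h` copies of `clique 1`, and pendant vertices filling up the order. The
-- join has 4t² + 3t + 2ts more edges than vertices, where t copies of `clique 1` would have 6t,
-- whence the equation for `D`.
level : ∀ t h s r D q → D + 3 * t ≡ 4 * t * t + 2 * t * s + r → r < 2 * t → s ≤ q →
        InES (4 * (t + h) + 11 + q) (3 + (t + h)) (4 * (t + h) + 11 + q + 6 * (t + h) + 11 + D)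
level t h s r D q D≡ r<2t s≤q
  with tuning r
... | As , σ , As-profile , 2σ≤ with ℕ.m≤n⇒∃[o]m+o≡n s≤q | ℕ.m≤n⇒∃[o]m+o≡n σ≤8+t
  where
  σ≤8+t : σ ≤ 8 + t
  σ≤8+t = s≤s⁻¹ (ℕ.*-cancelˡ-< 2 σ (9 + t) (ℕ.≤-<-trans (ℕ.≤-trans (ℕ.≤-reflexive (double σ)) 2σ≤)
    (ℕ.<-≤-trans (ℕ.+-monoʳ-< 18 r<2t) (ℕ.≤-reflexive (distrib t)))))
    where
    double : ∀ σ → 2 * σ ≡ σ + σ
    double = solve-∀
    distrib : ∀ t → 18 + 2 * t ≡ 2 * (9 + t)
    distrib = solve-∀
... | q′ , refl | σ′ , σ+σ′≡ = realise
  (profile-++ {Bs = join t s ∷ []} (profile refl refl refl)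
    (profile-++ As-profile
      (profile-++ (profile-replicate h (clique 1)) (profile-replicate (q′ + σ′) (clique 0)))))
  size (caps t h (q′ + σ′)) edges
  where
  open ≡-Reasoning
  caps : ∀ t h p → suc (t + 0 + (2 + (h * 1 + p * 0))) ≡ 3 + (t + h)
  caps = solve-∀
  size : suc (suc (t + t) + suc (t + s) + 0 + (σ + (h * 4 + (q′ + σ′) * 1))) ≡ 4 * (t + h) + 11 + (s + q′)
  size = trans (lhs t s σ h q′ σ′) (trans (cong (λ z → z + (3 + 3 * t + s + 4 * h + q′)) σ+σ′≡) (rhs t s h q′))
    where
    lhs : ∀ t s σ h q σ′ → suc (suc (t + t) + suc (t + s) + 0 + (σ + (h * 4 + (q + σ′) * 1))) ≡
                           σ + σ′ + (3 + 3 * t + s + 4 * h + q)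
    lhs = solve-∀
    rhs : ∀ t s h q → 8 + t + (3 + 3 * t + s + 4 * h + q) ≡ 4 * (t + h) + 11 + (s + q)
    rhs = solve-∀
  edges : blockEdges (join t s) + 0 + (σ + 12 + r + (h * 10 + (q′ + σ′) * 1)) ≡
          4 * (t + h) + 11 + (s + q′) + 6 * (t + h) + 11 + D
  edges = begin
    blockEdges (join t s) + 0 + (σ + 12 + r + (h * 10 + (q′ + σ′) * 1))
      ≡⟨ cong (λ z → z + 0 + (σ + 12 + r + (h * 10 + (q′ + σ′) * 1))) (blockEdges-join t s) ⟩
    2 + 6 * t + 4 * t * t + s + 2 * t * s + 0 + (σ + 12 + r + (h * 10 + (q′ + σ′) * 1))
      ≡⟨ collect t s σ r h q′ σ′ ⟩
    4 * t * t + 2 * t * s + r + (σ + σ′) + (14 + 6 * t + s + 10 * h + q′)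
      ≡⟨ cong₂ (λ x y → x + y + (14 + 6 * t + s + 10 * h + q′)) (sym D≡) σ+σ′≡ ⟩
    D + 3 * t + (8 + t) + (14 + 6 * t + s + 10 * h + q′)
      ≡⟨ expand t s h q′ D ⟩
    4 * (t + h) + 11 + (s + q′) + 6 * (t + h) + 11 + D ∎
    where
    collect : ∀ t s σ r h q σ′ →
      2 + 6 * t + 4 * t * t + s + 2 * t * s + 0 + (σ + 12 + r + (h * 10 + (q + σ′) * 1)) ≡
      4 * t * t + 2 * t * s + r + (σ + σ′) + (14 + 6 * t + s + 10 * h + q)
    collect = solve-∀
    expand : ∀ t s h q D → D + 3 * t + (8 + t) + (14 + 6 * t + s + 10 * h + q) ≡
                           4 * (t + h) + 11 + (s + q) + 6 * (t + h) + 11 + D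
    expand = solve-∀

-- Overlapping levels cover the range

-- `K` is the capacity left beside the tuning pair, that is k - 3.
Level : ℕ → ℕ → ℕ → Set
Level K D q = ∃[ t ] ∃[ h ] ∃[ s ] ∃[ r ]
  t + h ≡ K × D + 3 * t ≡ 4 * t * t + 2 * t * s + r × r < 2 * t × s ≤ q

level⇒InES : ∀ {K D q} → Level K D q → InES (4 * K + 11 + q) (3 + K) (4 * K + 11 + q + 6 * K + 11 + D)
level⇒InES {D = D} {q} (t , h , s , r , refl , D≡ , r<2t , s≤q) = level t h s r D q D≡ r<2t s≤q

-- One more `clique 1` leaves `D` unchanged, because `D` is measured against a graph made of such
-- blocks and pendant vertices.
weaken-level : ∀ {K D q} → Level K D q → Level (suc K) D q
weaken-level (t , h , s , r , t+h≡K , rest) =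
  t , suc h , s , r , trans (ℕ.+-suc t h) (cong suc t+h≡K) , rest

-- The quotient by 2t becomes the number `s` of additional independent vertices, and the remainder
-- is left to the tuning pair.
divide : ∀ t b x q → .{{_ : NonZero (2 * t)}} → b ≤ x → x < b + 2 * t * suc q →
         ∃[ s ] ∃[ r ] x ≡ b + 2 * t * s + r × r < 2 * t × s ≤ q
divide t b x q b≤x x< = s , r , eq , m%n<n (x ∸ b) (2 * t) ,
  s≤s⁻¹ (ℕ.*-cancelˡ-< (2 * t) s (suc q) (ℕ.+-cancelˡ-< b _ _
    (ℕ.≤-<-trans (ℕ.≤-trans (ℕ.m≤m+n _ r) (ℕ.≤-reflexive (sym eq))) x<)))
  where
  s = (x ∸ b) / (2 * t)
  r = (x ∸ b) % (2 * t)
  shuffle : ∀ b c s r → b + (r + s * c) ≡ b + c * s + r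
  shuffle = solve-∀
  eq : x ≡ b + 2 * t * s + r
  eq = trans (sym (ℕ.m+[n∸m]≡n b≤x))
    (trans (cong (b +_) (m≡m%n+[m/n]*n (x ∸ b) (2 * t))) (shuffle b (2 * t) s r))

-- Begin with the largest join and lower its capacity while `D` lies below the interval it reaches.
-- Consecutive intervals leave no gap for q ≥ 4, as `lower` shows. The descent stops at capacity 1,
-- where 1 ≤ D gives D + 3 ≥ 4, the lower end.
choose-level : ∀ t D q → 1 ≤ D → 4 ≤ q → D + 3 * suc t < 4 * suc t * suc t + 2 * suc t * suc q →
               Level (suc t) D q
choose-level t D q 1≤D 4≤q D< =
  [ here-level , below t D< ]′ (ℕ.≤-<-connex (4 * suc t * suc t) (D + 3 * suc t))
  where
  here-level : 4 * suc t * suc t ≤ D + 3 * suc t → Level (suc t) D q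
  here-level 4tt≤ =
    let s , r , rest = divide (suc t) (4 * suc t * suc t) (D + 3 * suc t) q 4tt≤ D<
    in suc t , 0 , s , r , ℕ.+-identityʳ (suc t) , rest
  left : ∀ t D → D + 3 * suc t + 3 ≡ D + 3 * suc (suc t)
  left = solve-∀
  -- The factor 5 is the least value of `suc q`, and the summand 3 is the change of 3t from one
  -- capacity to the next.
  right : ∀ t → 4 * suc (suc t) * suc (suc t) + (2 * t + 1) ≡ 4 * suc t * suc t + 2 * suc t * 5 + 3
  right = solve-∀
  lower : ∀ t → D + 3 * suc (suc t) < 4 * suc (suc t) * suc (suc t) →
            D + 3 * suc t < 4 * suc t * suc t + 2 * suc t * suc q
  lower t D<′ = ℕ.+-cancelʳ-< 3 _ _ (begin-strict
    D + 3 * suc t + 3                             ≡⟨ left t D ⟩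
    D + 3 * suc (suc t)                           <⟨ D<′ ⟩
    4 * suc (suc t) * suc (suc t)                 ≤⟨ ℕ.m≤m+n _ (2 * t + 1) ⟩
    4 * suc (suc t) * suc (suc t) + (2 * t + 1)   ≡⟨ right t ⟩
    4 * suc t * suc t + 2 * suc t * 5 + 3         ≤⟨ ℕ.+-monoˡ-≤ 3 (ℕ.+-monoʳ-≤ (4 * suc t * suc t) (ℕ.*-monoʳ-≤ (2 * suc t) (s≤s 4≤q))) ⟩
    4 * suc t * suc t + 2 * suc t * suc q + 3     ∎)
    where open ℕ.≤-Reasoning
  below : ∀ t → D + 3 * suc t < 4 * suc t * suc t + 2 * suc t * suc q →
          D + 3 * suc t < 4 * suc t * suc t → Level (suc t) D q
  below zero    _ D<4 = contradiction (ℕ.+-monoˡ-≤ 3 1≤D) (ℕ.<⇒≱ D<4)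
  below (suc t) _ D<′ = weaken-level {D = D} (choose-level t D q 1≤D 4≤q (lower t D<′))

-- Translation into the bounds on n and m

sat-bound : ∀ k n → 3 ≤ k → 4 * k ∸ 3 ≤ n → SatLe n k (n + 6 * k ∸ 7)
sat-bound (suc κ) n _ n≥
  with ℕ.m≤n⇒∃[o]m+o≡n n≥
... | p , refl = let G , sat , eq = subst (λ n → InES n (suc κ) (10 * κ + p)) size (minimal κ p) in
  G , sat , ℕ.≤-reflexive (trans eq (sym edges))
  where
  four : ∀ κ → 4 * suc κ ≡ suc (4 * κ) + 3
  four = solve-∀
  size : suc (4 * κ + p) ≡ 4 * suc κ ∸ 3 + p
  size = cong (_+ p) (sym (trans (cong (_∸ 3) (four κ)) (ℕ.m+n∸n≡m (suc (4 * κ)) 3)))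
  seven : ∀ κ p → suc (4 * κ + p) + 6 * suc κ ≡ 10 * κ + p + 7
  seven = solve-∀
  edges : 4 * suc κ ∸ 3 + p + 6 * suc κ ∸ 7 ≡ 10 * κ + p
  edges = trans (cong (λ n → n + 6 * suc κ ∸ 7) (sym size))
            (trans (cong (_∸ 7) (seven κ p)) (ℕ.m+n∸n≡m (10 * κ + p) 7))

-- Every level has D ≥ 4t² - 3t ≥ 1, so D = 0 is supplied by `minimal` instead.
interval : ∀ t q D → 4 ≤ q → D + 5 ≤ 2 * suc t * suc t + suc t + 2 * suc t * q →
           InES (4 * suc t + 11 + q) (3 + suc t) (4 * suc t + 11 + q + 6 * suc t + 11 + D)
interval t q zero 4≤q _ = subst₂ (λ n m → InES n (4 + t) m) (size t q) (edges t q) (minimal (3 + t) (q + 2))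
  where
  size : ∀ t q → suc (4 * (3 + t) + (q + 2)) ≡ 4 * suc t + 11 + q
  size = solve-∀
  edges : ∀ t q → 10 * (3 + t) + (q + 2) ≡ 4 * suc t + 11 + q + 6 * suc t + 11 + 0
  edges = solve-∀
interval t q D@(suc _) 4≤q D≤ = level⇒InES (choose-level t D q (s≤s z≤n) 4≤q below)
  where
  open ℕ.≤-Reasoning
  -- The largest join reaches beyond the bound on `D` by at least the slack `2 * t * suc t`.
  gap : ∀ t q → 2 * suc t * suc t + suc t + 2 * suc t * q + 3 * suc t + 2 * t * suc t ≡
                4 * suc t * suc t + 2 * suc t * suc q
  gap = solve-∀
  below : D + 3 * suc t < 4 * suc t * suc t + 2 * suc t * suc q
  below = begin-strict
    D + 3 * suc t                                                         <⟨ ℕ.+-monoˡ-< (3 * suc t) (ℕ.<-≤-trans (ℕ.m<m+n D {5} (s≤s z≤n)) D≤) ⟩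
    2 * suc t * suc t + suc t + 2 * suc t * q + 3 * suc t                 ≤⟨ ℕ.m≤m+n _ (2 * t * suc t) ⟩
    2 * suc t * suc t + suc t + 2 * suc t * q + 3 * suc t + 2 * t * suc t ≡⟨ gap t q ⟩
    4 * suc t * suc t + 2 * suc t * suc q                                 ∎

-- With k = 4 + t the conclusion is n ≥ 4k + 3, which yields the condition q ≥ 4 for overlapping
-- levels. The two bounds on n differ by 4j² + 15j + 9, where j = k - 5.
order-bound : ∀ t n → (4 * (4 + t) * (4 + t) + 37) ∸ 21 * (4 + t) ≤ n → 1 ≤ t → 4 * suc t + 15 ≤ n
order-bound (suc j) n n≥ _ = ℕ.+-cancelˡ-≤ (21 * (5 + j)) _ _ (begin
  21 * (5 + j) + (4 * (2 + j) + 15)                             ≤⟨ ℕ.m≤m+n _ (4 * j * j + 15 * j + 9) ⟩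
  21 * (5 + j) + (4 * (2 + j) + 15) + (4 * j * j + 15 * j + 9)  ≡⟨ slack j ⟩
  4 * (5 + j) * (5 + j) + 37                                    ≤⟨ ℕ.m≤n+m∸n _ (21 * (5 + j)) ⟩
  21 * (5 + j) + (4 * (5 + j) * (5 + j) + 37 ∸ 21 * (5 + j))    ≤⟨ ℕ.+-monoʳ-≤ (21 * (5 + j)) n≥ ⟩
  21 * (5 + j) + n                                              ∎)
  where
  open ℕ.≤-Reasoning
  slack : ∀ j → 21 * (5 + j) + (4 * (2 + j) + 15) + (4 * j * j + 15 * j + 9) ≡ 4 * (5 + j) * (5 + j) + 37
  slack = solve-∀

edge-base : ∀ t n → n + 6 * (4 + t) ∸ 7 ≡ n + 6 * suc t + 11
edge-base t n = trans (cong (_∸ 7) (seven t n)) (ℕ.m+n∸n≡m (n + 6 * suc t + 11) 7)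
  where
  seven : ∀ t n → n + 6 * (4 + t) ≡ n + 6 * suc t + 11 + 7
  seven = solve-∀

-- For k = 4 + t the factor 2k - 5 equals 2(t + 1) + 1. One copy of `n` cancels and the others are
-- expanded in `q`, which turns the upper end of the range into a bound on `D`.
surplus-bound : ∀ t q D {n m} → n ≡ 4 * suc t + 11 + q → m ≡ n + 6 * suc t + 11 + D →
  m + 6 * (4 + t) * (4 + t) + 3 ≤ (2 * (4 + t) ∸ 5) * n + 21 * (4 + t) →
  D + 5 ≤ 2 * suc t * suc t + suc t + 2 * suc t * q
surplus-bound t q D {n} {m} n≡ m≡ m≤ = ℕ.+-cancelʳ-≤ (n + rest) _ _ (begin
  D + 5 + (n + rest)                                                ≡⟨ left t n D ⟩
  n + 6 * suc t + 11 + D + 6 * (4 + t) * (4 + t) + 3 + 5            ≡⟨ cong (λ z → z + 6 * (4 + t) * (4 + t) + 3 + 5) (sym m≡) ⟩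
  m + 6 * (4 + t) * (4 + t) + 3 + 5                                 ≤⟨ ℕ.+-monoˡ-≤ 5 m≤ ⟩
  (2 * (4 + t) ∸ 5) * n + 21 * (4 + t) + 5                          ≡⟨ cong (λ z → z * n + 21 * (4 + t) + 5) five ⟩
  (2 * t + 3) * n + 21 * (4 + t) + 5                                ≡⟨ split t n ⟩
  2 * suc t * n + (n + 21 * (4 + t) + 5)                            ≡⟨ cong (λ z → 2 * suc t * z + (n + 21 * (4 + t) + 5)) n≡ ⟩
  2 * suc t * (4 * suc t + 11 + q) + (n + 21 * (4 + t) + 5)         ≡⟨ right t q n ⟩
  2 * suc t * suc t + suc t + 2 * suc t * q + (n + rest)            ∎)
  where
  open ℕ.≤-Reasoning
  rest = 6 * suc t + 11 + 6 * (4 + t) * (4 + t) + 3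
  left : ∀ t n D → D + 5 + (n + (6 * suc t + 11 + 6 * (4 + t) * (4 + t) + 3)) ≡
                   n + 6 * suc t + 11 + D + 6 * (4 + t) * (4 + t) + 3 + 5
  left = solve-∀
  double : ∀ t → 2 * (4 + t) ≡ 2 * t + 3 + 5
  double = solve-∀
  five : 2 * (4 + t) ∸ 5 ≡ 2 * t + 3
  five = trans (cong (_∸ 5) (double t)) (ℕ.m+n∸n≡m (2 * t + 3) 5)
  split : ∀ t n → (2 * t + 3) * n + 21 * (4 + t) + 5 ≡ 2 * suc t * n + (n + 21 * (4 + t) + 5)
  split = solve-∀
  right : ∀ t q n → 2 * suc t * (4 * suc t + 11 + q) + (n + 21 * (4 + t) + 5) ≡
                    2 * suc t * suc t + suc t + 2 * suc t * q + (n + (6 * suc t + 11 + 6 * (4 + t) * (4 + t) + 3))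
  right = solve-∀

spectrum : ∀ k n → 5 ≤ k → (4 * k * k + 37) ∸ (21 * k) ≤ n → ∀ m → n + 6 * k ∸ 7 ≤ m →
           m + 6 * k * k + 3 ≤ (2 * k ∸ 5) * n + 21 * k → InES n k m
spectrum (suc (suc (suc (suc t)))) n (s≤s (s≤s (s≤s (s≤s 1≤t)))) n≥ m m≥ m≤ =
  subst₂ (λ n m → InES n (4 + t) m) (sym n≡) (sym (trans m≡ (cong (λ n → n + 6 * suc t + 11 + D) n≡)))
    (interval t (4 + q) D (ℕ.m≤m+n 4 q) (surplus-bound t (4 + q) D n≡ m≡ m≤))
  where
  -- The order exceeds 4(k - 3) + 11 by `4 + q`, so `interval` receives a value of at least 4.
  q = n ∸ (4 * suc t + 15)
  D = m ∸ (n + 6 * (4 + t) ∸ 7)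
  regroup : ∀ x q → x + 15 + q ≡ x + 11 + (4 + q)
  regroup = solve-∀
  n≡ : n ≡ 4 * suc t + 11 + (4 + q)
  n≡ = trans (sym (ℕ.m+[n∸m]≡n (order-bound t n n≥ 1≤t))) (regroup (4 * suc t) q)
  m≡ : m ≡ n + 6 * suc t + 11 + D
  m≡ = trans (sym (ℕ.m+[n∸m]≡n m≥)) (cong (_+ D) (edge-base t n))

theorem1p5 : (∀ (k n : ℕ) → 3 ≤ k → 4 * k ∸ 3 ≤ n → SatLe n k (n + 6 * k ∸ 7))
    ×
    (∀ (k n : ℕ) → 5 ≤ k → (4 * k * k + 37) ∸ (21 * k) ≤ n →
    ∀ (m : ℕ) → n + 6 * k ∸ 7 ≤ m → m + 6 * k * k + 3 ≤ (2 * k ∸ 5) * n + 21 * k →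
    InES n k m)
theorem1p5 = sat-bound , spectrum
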